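{- Let $\mathsf{RA}$ be the Release-Acquire memory model with lifting function $\mathit{map}_{\mathsf{RA}}$ as defined in the context. Then each of the following Hoare-triple rules is sound for $\mathsf{RA}$ (for all threads $\tau,\eta\in\mathsf{Tid}$, positions $l$ of thread $\tau$, locations $x$, registers $a$, expressions $e,e_1,e_2$ over registers, interval assertions $I,I_\tau$, and assertions $\varphi,\psi$; $\varphi(a:=e)$ denotes substitution of $e$ for $a$ in $\varphi$, and "$\chi\notin\varphi$" means that $\chi$ does not occur as a subterm of $\varphi$): 1. (Stbl-St) If $x\notin\mathit{fv}(\varphi)$ and $\mathsf{at}\_l\notin\varphi$: $\{\varphi\}\ \tau\mapsto l:\mathbf{STORE}(x,e)\ \{\varphi\}$. 2. (Stbl-Rmw) If $x,a\notin\mathit{fv}(\varphi)$, $\mathsf{at}\_l\notin\varphi$, and $\neg(\tau\uparrow y)\notin\varphi$ for all locations $y$: $\{\varphi\}\ \tau\mapsto l: a:=\mathbf{FADD}(x,e)\ \{\varphi\}$. 3. (Stbl-Ld) If $a\notin\mathit{fv}(\varphi)$, $\mathsf{at}\_l\notin\varphi$, and $\neg(\tau\uparrow y)\notin\varphi$ for all locations $y$: $\{\varphi\}\ \tau\mapsto l: a:=\mathbf{LOAD}(x)\ \{\varphi\}$. 4. (Sub) If $\mathsf{at}\_l\notin\varphi$: $\{\varphi(a:=e)\}\ \tau\mapsto l: a:=e\ \{\varphi\}$. 5. (Pc) $\{\mathsf{at}\_l\}\ \tau\mapsto l: C\ \{\mathsf{at}\_{\mathsf{next}(l)}\}$ for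 any command $C$ at position $l$. 6. (St) $\{\tau\uparrow x\}\ \tau\mapsto l:\mathbf{STORE}(x,e)\ \{\tau\uparrow x\ \wedge\ \tau\ltimes[x=e]\ \wedge\ \vec{x}=e\}$. 7. (St-Other) If $\eta\neq\tau$ and $x\notin\mathit{fv}(I_\tau)$: $\{\tau\ltimes I_\tau\ \wedge\ \eta\ltimes (I\,;I_\tau)\}\ \tau\mapsto l:\mathbf{STORE}(x,e)\ \{\eta\ltimes (I\,;I_\tau)\}$. 8. (Rmw) $\{\mathtt{C}(x)\wedge\vec{x}=e_1\}\ \tau\mapsto l: a:=\mathbf{FADD}(x,e_2)\ \{\mathtt{C}(x)\wedge\vec{x}=e_1+e_2\wedge\tau\ltimes[x=e_1+e_2]\}$. 9. (Ld) $\{\tau\uparrow x\wedge e(a:=\vec{x})\}\ \tau\mapsto l: a:=\mathbf{LOAD}(x)\ \{e\}$. 10. (Ld-Sh) If the triple $\{\tau\ltimes I\}\ \tau\mapsto l: a:=\mathbf{LOAD}(x)\ \{\psi\}$ holds, then $\{\tau\ltimes([e(a:=x)]\,;I)\}\ \tau\mapsto l: a:=\mathbf{LOAD}(x)\ \{e\vee\psi\}$.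
   Context: **Programs.** $\mathsf{Val}=\mathbb{N}$; $\mathsf{Loc}$ is a set of shared locations, $\mathsf{Reg}$ a set of local registers (disjoint between threads), $\mathsf{Tid}$ a finite set of thread identifiers including an initializing thread $\mathtt{T}_0$, $\mathsf{PC}$ a set of program positions (disjoint between threads). Expressions $e$ are built from registers and values; $\gamma(e)$ is the value of $e$ in a register store $\gamma:\mathsf{Reg}\to\mathsf{Val}$. A concurrent program $\mathcal{C}_0$ assigns to each thread a sequential program whose commands carry positions $l$; commands are $a:=e$, $\mathbf{STORE}(x,e)$, $a:=\mathbf{LOAD}(x)$, $a:=\mathbf{FADD}(x,e)$ (fetch-and-add), SKIP, sequencing, if-then-else and while. A program state is $(\mathcal{C},(\gamma,pc))$ with $\mathcal{C}$ the remaining program and $pc:\mathsf{Tid}\to\mathsf{PC}$; initially $\gamma$ is constantly $0$ and $pc$ gives first positions. A step of thread $\tau$ at position $l=pc(\tau)$ carries a label $(\tau,\ell,l)$: for $a:=e$, $\ell=\varepsilon$ and $\gamma'=\gamma[a\mapsto\gamma(e)]$; for $\mathbf{STORE}(x,e)$, $\ell=\mathtt{W}(x,\gamma(e))$ and $\gamma'=\gamma$; for $a:=\mathbf{LOAD}(x)$, $\ell=\mathtt{R}(x,v)$ and $\gamma'=\gamma[a\mapsto v]$, $v$ arbitrary; for $a:=\mathbf{FADD}(x,e)$, $\ell=\mathtt{RMW}(x,v,v+\gamma(e))$ and $\gamma'=\gamma[a\mapsto v]$, $v$ arbitrary; tests of if/while have $\ell=\varepsilon$ and leave $\gamma$ unchanged.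 In every step $pc'=pc[\tau\mapsto\mathsf{next}(l)]$, where $\mathsf{next}(l)$ is the position of the next instruction (for if/while, that of the branch determined by the test). **Memory model RA.** A view is a map $\mathsf{Loc}\to\mathbb{N}$ (timestamps); $\sqcup$ is pointwise maximum. A state is $q=\langle M,\nu\rangle$, where $M$ is a set of messages $\langle x:v@t,\tau,V\rangle$ (location, value, timestamp, writing thread, view; components $m.\mathtt{loc},m.\mathtt{val},m.\mathtt{ts},m.\mathtt{tid},m.\mathtt{view}$) and $\nu$ maps each thread to a view. $M_{|x}$ is the set of $m\in M$ with $m.\mathtt{loc}=x$. Initially $M_0=\{\langle x:0@0,\mathtt{T}_0,V_0\rangle\mid x\in\mathsf{Loc}\}$ with $V_0\equiv 0$, and $\nu_0(\tau)=V_0$ for all $\tau$. The only internal label is $\mathsf{prop}$. Transitions: - Read: $q\xrightarrow{\tau,\mathtt{R}(x,v)}q$ if some $\langle x:v@t,\cdot,\cdot\rangle\in M$ has $\nu(\tau)(x)=t$. - Write: if no $m\in M_{|x}$ has $m.\mathtt{ts}=t$ and $\nu(\tau)(x)<t$, then with $V=\nu(\tau)[x\mapsto t]$: $q\xrightarrow{\tau,\mathtt{W}(x,v)}\langle M\cup\{\langle x:v@t,\tau,V\rangle\},\nu[\tau\mapsto V]\rangle$. - RMW: $q\xrightarrow{\tau,\mathtt{RMW}(x,v_r,v_w)}q'$ if $q\xrightarrow{\tau,\mathtt{R}(x,v_r)}q\xrightarrow{\tau,\mathtt{W}(x,v_w)}q'$ and $q'.\nu(\tau)(x)=q.\nu(\tau)(x)+1$.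 - Propagate: for $m\in M$ and $\tau\in\mathsf{Tid}$ with $\nu(\tau)(m.\mathtt{loc})<m.\mathtt{ts}$: $q\xrightarrow{\mathsf{prop}}\langle M,\nu[\tau\mapsto\nu(\tau)\sqcup m.\mathtt{view}]\rangle$. **Combined LTS.** States $\langle\mathcal{C},(\gamma,pc),q\rangle$. Steps: (1) joint program and memory steps with common $(\tau,\ell)$ for read/write/RMW labels $\ell$; (2) program $\varepsilon$-steps leaving $q$ unchanged; (3) memory-internal steps leaving the program state unchanged. States are those reachable from the initial states. **Potentials.** A potential store $\beta$ maps each location to a tuple (value, thread id, covered flag in $\{T,F\}$, timestamp), with components $.\mathtt{val},.\mathtt{tid},.\mathtt{flag},.\mathtt{ts}$. A potential is a non-empty set of lists of potential stores; a potential mapping $\mathcal{B}$ assigns a potential to each thread such that all lists agree on the last store. $\#L$ is the length of $L$, $L[i]$ its $i$-th element. **Lifting for RA.** For thread $\tau$ and location $x$ let $m_\tau\in q.M_{|x}$ be the message with $m_\tau.\mathtt{ts}=q.\nu(\tau)(x)$, and let $\Delta_\tau(q)(x)=(m_\tau.\mathtt{val},m_\tau.\mathtt{tid},\mathit{cov}_q(m_\tau),m_\tau.\mathtt{ts})$, where $\mathit{cov}_q(m)=T$ iff $m.\mathtt{ts}$ is maximal among timestamps in $q.M_{|x}$ or some $m'\in q.M_{|x}$ has $m'.\mathtt{ts}=m.\mathtt{ts}+1$. Then $$\mathit{map}_{\mathsf{RA}}(q)(\tau)=\Big\{\langle\Delta_\tau(q)\rangle\cdot L\ \Big|\ L\in\bigcup_{q\xrightarrow{\mathsf{prop}}q'}\mathit{map}_{\mathsf{RA}}(q')(\tau)\Big\},$$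 and $\mathit{map}_{\mathsf{RA}}(q)(\tau)=\{\langle\Delta_\tau(q)\rangle\}$ if $q$ has no $\mathsf{prop}$ transition. **Piccolo assertions.** Extended expressions $E$ are built like expressions, but may also contain locations $x$ and current values $\vec{x}$; in $(\gamma,\beta,L)$, registers are evaluated by $\gamma$, $x$ by $\beta(x).\mathtt{val}$, and $\vec{x}$ by $L[\#L](x).\mathtt{val}$. Interval assertions: $I::=[E]\mid I;I$. A list $L$ satisfies $[E]$ if $E$ is true for every $\beta$ in $L$, and satisfies $I_1;I_2$ if $L=L_1\cdot L_2$ for some (possibly empty) $L_1,L_2$ with $L_1\models I_1$, $L_2\models I_2$. Assertions are built with $\wedge$, $\vee$ from: - $\tau\ltimes I$: every $L\in\mathcal{B}(\tau)$ satisfies $I$; - $\mathtt{C}(x)$: $L[i](x).\mathtt{flag}=T$ for every $\tau$, $L\in\mathcal{B}(\tau)$, $1\le i\le\#L$; - $\mathsf{dist}(\tau,x)=n$: $\max_{L\in\mathcal{B}(\tau)}\#\{L[i](x)\mid L[i](x)\ne L[\#L](x)\}=n$; - $\mathsf{at}\_l$: $pc(\tau)=l$ for some $\tau$; - Boolean expressions over registers (true under $\gamma$), possibly containing current values $\vec{x}$, evaluated in the common last store. $\tau\uparrow x$ (view maximality) abbreviates $\mathsf{dist}(\tau,x)=0$, and $\neg(\tau\uparrow x)$ means $\mathsf{dist}(\tau,x)=n$ for some $n\neq0$. $\mathit{fv}(\varphi)$ is the set of registers and locations occurring in $\varphi$. A combined state satisfies $\varphi$ iff $\langle(\gamma,pc),\mathit{map}_{\mathsf{RA}}(q)\rangle\models\varphi$.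 **Soundness.** A triple $\{\varphi\}\ \tau\mapsto l:c\ \{\psi\}$ holds in a memory model if, for every combined LTS (of any concurrent program), for all states $\mathbf{q},\mathbf{q}'$: if $\mathbf{q}\models\varphi$ and $\mathbf{q}\to\mathbf{q}'$ is a transition of thread $\tau$ executing command $c$ at position $l$, then $\mathbf{q}'\models\psi$. A rule is sound if its triple holds whenever its assumptions do.
   Formalization: Two rules, false as stated, get a side condition: in (Rmw) the register a must not occur in e₁ or e₂; in (St-Other) the current value of x (x with arrow) must not occur in I (x itself may). Current values in interval assertions refer to the last store of the whole list. -}

module Defs where

open import Level using (0ℓ)
open import Data.Nat using (ℕ; zero; suc; _+_; _≤_; _<_; _⊔_; _≡ᵇ_)
import Data.Nat.Properties as ℕₚ
open import Data.Bool using (Bool; true; false; if_then_else_)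
import Data.Bool.Properties as Boolₚ
open import Data.Fin using (Fin)
import Data.Fin.Properties as Finₚ
open import Data.List using (List; []; _∷_; _++_; _∷ʳ_; map; filter; deduplicate; length)
open import Data.List.NonEmpty using (List⁺; [_]; _∷⁺_; toList; last)
open import Data.List.Relation.Unary.All using (All)
open import Data.List.Relation.Unary.Unique.Propositional using (Unique)
open import Data.Maybe using (Maybe; just; nothing; maybe′)
open import Data.Product using (_×_; _,_; ∃; ∃-syntax; Σ-syntax)
open import Data.Product.Properties using (≡-dec)
open import Data.Sum using (_⊎_)
open import Function using (_∘_; const)
open import Function.Bundles using (_⇔_)
open import Relation.Binary.Definitions using (DecidableEquality)
open import Relation.Binary.PropositionalEquality using (_≡_; _≢_; refl; cong)
open import Relation.Nullary using (¬_; does)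
open import Relation.Nullary.Decidable using (map′; ¬?)
open import Relation.Unary using (Pred; _∪_; ｛_｝; _∈_)

update : {A B : Set} → DecidableEquality A → (A → B) → A → B → A → B
update _≟_ f a b a′ = if does (a′ ≟ a) then b else f a′

-- The operators of expressions are left open: any unary or binary function
-- on ℕ and Bool may be used.

data Sort : Set where
  nat bool : Sort

⟦_⟧ˢ : Sort → Set
⟦ nat ⟧ˢ  = ℕ
⟦ bool ⟧ˢ = Bool

data Exp (A : Set) : Sort → Set where
  var : A → Exp A nat
  lit : ∀ {s} → ⟦ s ⟧ˢ → Exp A s
  op₁ : ∀ {s t} → (⟦ s ⟧ˢ → ⟦ t ⟧ˢ) → Exp A s → Exp A t
  op₂ : ∀ {s t u} → (⟦ s ⟧ˢ → ⟦ t ⟧ˢ → ⟦ u ⟧ˢ) → Exp A s → Exp A t → Exp A u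

eval : ∀ {A s} → (A → ℕ) → Exp A s → ⟦ s ⟧ˢ
eval ρ (var a)      = ρ a
eval ρ (lit v)      = v
eval ρ (op₁ f e)    = f (eval ρ e)
eval ρ (op₂ f e e′) = f (eval ρ e) (eval ρ e′)

vars : ∀ {A s} → Exp A s → List A
vars (var a)      = a ∷ []
vars (lit _)      = []
vars (op₁ _ e)    = vars e
vars (op₂ _ e e′) = vars e ++ vars e′

bind : ∀ {A B s} → (A → Exp B nat) → Exp A s → Exp B s
bind σ (var a)      = σ a
bind σ (lit v)      = lit v
bind σ (op₁ f e)    = op₁ f (bind σ e)
bind σ (op₂ f e e′) = op₂ f (bind σ e) (bind σ e′)

infixl 6 _⊕_
_⊕_ : ∀ {A} → Exp A nat → Exp A nat → Exp A nat
_⊕_ = op₂ _+_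

infix 5 _≐_
_≐_ : ∀ {A} → Exp A nat → Exp A nat → Exp A bool
_≐_ = op₂ _≡ᵇ_

-- regTid and pcTid express that registers and positions are disjoint between
-- threads: each belongs to exactly one thread.

record Signature : Set₁ where
  field
    others : ℕ  -- the number of threads besides T₀
    Loc    : Set
    Reg    : Set
    PC     : Set
    _≟ᴸ_   : DecidableEquality Loc
    _≟ᴿ_   : DecidableEquality Reg

  Tid : Set
  Tid = Fin (suc others)

  T₀ : Tid
  T₀ = Fin.zero

  field
    regTid : Reg → Tid
    pcTid  : PC → Tid

module Piccolo (S : Signature) where
  open Signature S public

  Store : Set
  Store = Reg → ℕ

  infix 8 _[_↦_]ᴿ _[_↦_]ᴸ _[_↦_]ᵀ

  _[_↦_]ᴿ : Store → Reg → ℕ → Store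
  _[_↦_]ᴿ = update _≟ᴿ_

  _[_↦_]ᴸ : (Loc → ℕ) → Loc → ℕ → (Loc → ℕ)
  _[_↦_]ᴸ = update _≟ᴸ_

  _[_↦_]ᵀ : {B : Set} → (Tid → B) → Tid → B → (Tid → B)
  _[_↦_]ᵀ = update Finₚ._≟_

  infix  6 _⦂_
  infixr 5 _⨟_

  mutual
    data Com : Set where
      _⦂_ : PC → Cmd → Com
      _⨟_ : Com → Com → Com

    data Cmd : Set where
      _≔_   : Reg → Exp Reg nat → Cmd
      STORE : Loc → Exp Reg nat → Cmd
      LOAD  : Reg → Loc → Cmd
      FADD  : Reg → Loc → Exp Reg nat → Cmd
      SKIP  : Cmd
      IF    : Exp Reg bool → Com → Com → Cmd
      WHILE : Exp Reg bool → Com → Cmd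

  mutual
    regs : Com → List Reg
    regs (_ ⦂ c) = regsᶜ c
    regs (C ⨟ D) = regs C ++ regs D

    regsᶜ : Cmd → List Reg
    regsᶜ (a ≔ e)      = a ∷ vars e
    regsᶜ (STORE _ e)  = vars e
    regsᶜ (LOAD a _)   = a ∷ []
    regsᶜ (FADD a _ e) = a ∷ vars e
    regsᶜ SKIP         = []
    regsᶜ (IF b C D)   = vars b ++ regs C ++ regs D
    regsᶜ (WHILE b C)  = vars b ++ regs C

  mutual
    positions : Com → List PC
    positions (l ⦂ c) = l ∷ positionsᶜ c
    positions (C ⨟ D) = positions C ++ positions D

    positionsᶜ : Cmd → List PC
    positionsᶜ (IF _ C D)  = positions C ++ positions D
    positionsᶜ (WHILE _ C) = positions C
    positionsᶜ _           = []

  first : Com → PC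
  first (l ⦂ _) = l
  first (C ⨟ _) = first C

  -- exit τ is the position of thread τ after its last instruction.
  record Program : Set where
    field
      code      : Tid → Com
      exit      : Tid → PC
      ownRegs   : ∀ τ → All (λ a → regTid a ≡ τ) (regs (code τ))
      ownPCs    : ∀ τ → All (λ l → pcTid l ≡ τ) (positions (code τ) ∷ʳ exit τ)
      uniquePCs : ∀ τ → Unique (positions (code τ) ∷ʳ exit τ)

  data Label : Set where
    ε   : Label
    R   : Loc → (v : ℕ) → Label
    W   : Loc → (v : ℕ) → Label
    RMW : Loc → (vᵣ v_w : ℕ) → Label

  -- What remains of a thread; nothing once it has terminated.
  Rest : Set
  Rest = Maybe Com

  infixr 5 _⨟?_
  _⨟?_ : Rest → Com → Com
  r ⨟? D = maybe′ (_⨟ D) D r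

  infix 3 _-[_∶_,_]→_
  data _-[_∶_,_]→_ : Com × Store → PC → Cmd → Label → Rest × Store → Set where
    assign : ∀ {l a e γ} →
      (l ⦂ a ≔ e , γ) -[ l ∶ a ≔ e , ε ]→ (nothing , γ [ a ↦ eval γ e ]ᴿ)
    store : ∀ {l x e γ} →
      (l ⦂ STORE x e , γ) -[ l ∶ STORE x e , W x (eval γ e) ]→ (nothing , γ)
    load : ∀ {l a x γ} v →
      (l ⦂ LOAD a x , γ) -[ l ∶ LOAD a x , R x v ]→ (nothing , γ [ a ↦ v ]ᴿ)
    fadd : ∀ {l a x e γ} v →
      (l ⦂ FADD a x e , γ) -[ l ∶ FADD a x e , RMW x v (v + eval γ e) ]→
      (nothing , γ [ a ↦ v ]ᴿ)
    skip : ∀ {l γ} →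
      (l ⦂ SKIP , γ) -[ l ∶ SKIP , ε ]→ (nothing , γ)
    if-true : ∀ {l b C D γ} → eval γ b ≡ true →
      (l ⦂ IF b C D , γ) -[ l ∶ IF b C D , ε ]→ (just C , γ)
    if-false : ∀ {l b C D γ} → eval γ b ≡ false →
      (l ⦂ IF b C D , γ) -[ l ∶ IF b C D , ε ]→ (just D , γ)
    while-true : ∀ {l b C γ} → eval γ b ≡ true →
      (l ⦂ WHILE b C , γ) -[ l ∶ WHILE b C , ε ]→ (just (C ⨟ (l ⦂ WHILE b C)) , γ)
    while-false : ∀ {l b C γ} → eval γ b ≡ false →
      (l ⦂ WHILE b C , γ) -[ l ∶ WHILE b C , ε ]→ (nothing , γ)
    seq : ∀ {C D γ l c ℓ r γ′} →
      (C , γ) -[ l ∶ c , ℓ ]→ (r , γ′) →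
      (C ⨟ D , γ) -[ l ∶ c , ℓ ]→ (just (r ⨟? D) , γ′)

  record PState : Set where
    constructor pstate
    field
      prog : Tid → Rest
      reg  : Store
      pc   : Tid → PC

  -- The last index of a step is next(l), the position of the instruction
  -- that thread τ executes next.
  data PStep (P : Program) : PState → Tid → Label → PC → Cmd → PC → PState → Set where
    step : ∀ {𝒞 γ pc τ C l c ℓ r γ′} →
      let next = maybe′ first (Program.exit P τ) r in
      𝒞 τ ≡ just C → pc τ ≡ l →
      (C , γ) -[ l ∶ c , ℓ ]→ (r , γ′) →
      PStep P (pstate 𝒞 γ pc) τ ℓ l c next (pstate (𝒞 [ τ ↦ r ]ᵀ) γ′ (pc [ τ ↦ next ]ᵀ))

  initP : Program → PState
  initP P = pstate (just ∘ code) (const 0) (first ∘ code)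
    where open Program P

  View : Set
  View = Loc → ℕ

  _⊔ⱽ_ : View → View → View
  (V ⊔ⱽ V′) x = V x ⊔ V′ x

  record Message : Set where
    constructor ⟨_∶_at_,_,_⟩
    field
      loc  : Loc
      val  : ℕ
      ts   : ℕ
      tid  : Tid
      view : View

  record MState : Set₁ where
    constructor ⟨_,_⟩
    field
      M : Pred Message 0ℓ
      ν : Tid → View

  open MState

  _∣_ : MState → Loc → Pred Message 0ℓ
  (q ∣ x) m = m ∈ M q × Message.loc m ≡ x

  initM : MState
  initM = ⟨ (λ m → ∃[ x ] m ≡ ⟨ x ∶ 0 at 0 , T₀ , const 0 ⟩) , const (const 0) ⟩

  infix 3 _-[_,_]→ᴹ_
  data _-[_,_]→ᴹ_ : MState → Tid → Label → MState → Set₁ where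
    read : ∀ {q τ x m} →
      m ∈ (q ∣ x) → ν q τ x ≡ Message.ts m →
      q -[ τ , R x (Message.val m) ]→ᴹ q
    write : ∀ {q τ x v} t →
      (∀ m → m ∈ (q ∣ x) → Message.ts m ≢ t) → ν q τ x < t →
      let V = ν q τ [ x ↦ t ]ᴸ in
      q -[ τ , W x v ]→ᴹ ⟨ M q ∪ ｛ ⟨ x ∶ v at t , τ , V ⟩ ｝ , ν q [ τ ↦ V ]ᵀ ⟩
    rmw : ∀ {q q′ τ x vᵣ v_w} →
      q -[ τ , R x vᵣ ]→ᴹ q → q -[ τ , W x v_w ]→ᴹ q′ →
      ν q′ τ x ≡ ν q τ x + 1 →
      q -[ τ , RMW x vᵣ v_w ]→ᴹ q′

  infix 3 _-prop→_
  data _-prop→_ : MState → MState → Set₁ where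
    prop : ∀ {q m} τ →
      m ∈ M q → ν q τ (Message.loc m) < Message.ts m →
      q -prop→ ⟨ M q , ν q [ τ ↦ ν q τ ⊔ⱽ Message.view m ]ᵀ ⟩

  record State : Set₁ where
    constructor state
    field
      pst : PState
      mem : MState

  data Event : Set where
    internal : Event
    thread   : (τ : Tid) (l : PC) (c : Cmd) (next : PC) → Event

  data Step (P : Program) : State → Event → State → Set₁ where
    joint : ∀ {p p′ q q′ τ ℓ l c l′} →
      PStep P p τ ℓ l c l′ p′ → q -[ τ , ℓ ]→ᴹ q′ →
      Step P (state p q) (thread τ l c l′) (state p′ q′)
    silent : ∀ {p p′ q τ l c l′} →
      PStep P p τ ε l c l′ p′ →
      Step P (state p q) (thread τ l c l′) (state p′ q)
    internal : ∀ {p q q′} →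
      q -prop→ q′ →
      Step P (state p q) internal (state p q′)

  data Reachable (P : Program) : State → Set₁ where
    init : Reachable P (state (initP P) initM)
    step : ∀ {𝐪 ev 𝐪′} → Reachable P 𝐪 → Step P 𝐪 ev 𝐪′ → Reachable P 𝐪′

  record Entry : Set where
    constructor entry
    field
      val  : ℕ
      tid  : Tid
      flag : Bool
      ts   : ℕ

  _≟ᴱ_ : DecidableEquality Entry
  entry v τ f t ≟ᴱ entry v′ τ′ f′ t′ =
    map′ (λ { refl → refl }) (λ { refl → refl })
      (≡-dec ℕₚ._≟_ (≡-dec Finₚ._≟_ (≡-dec Boolₚ._≟_ ℕₚ._≟_))
        (v , τ , f , t) (v′ , τ′ , f′ , t′))

  PotStore : Set
  PotStore = Loc → Entry

  PotMapping : Set₂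
  PotMapping = Tid → Pred (List⁺ PotStore) (Level.suc 0ℓ)

  Covered : MState → Message → Set
  Covered q m =
    (∀ m′ → m′ ∈ (q ∣ Message.loc m) → Message.ts m′ ≤ Message.ts m)
    ⊎ (∃[ m′ ] m′ ∈ (q ∣ Message.loc m) × Message.ts m′ ≡ Message.ts m + 1)

  -- IsΔ τ q β is the graph of Δ: β ≡ Δ_τ(q) pointwise.  In reachable states the
  -- message m is unique, and covered-ness is decidable.
  IsΔ : Tid → MState → PotStore → Set
  IsΔ τ q β = ∀ x → ∃[ m ] m ∈ (q ∣ x) × Message.ts m ≡ ν q τ x
    × Entry.val (β x) ≡ Message.val m
    × Entry.tid (β x) ≡ Message.tid m
    × (Entry.flag (β x) ≡ true ⇔ Covered q m)
    × Entry.ts (β x) ≡ Message.ts m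

  data mapRA (q : MState) : PotMapping where
    end  : ∀ {τ β} → IsΔ τ q β → (∀ q′ → ¬ (q -prop→ q′)) → mapRA q τ [ β ]
    cons : ∀ {τ β q′ L} → IsΔ τ q β → q -prop→ q′ → L ∈ mapRA q′ τ → mapRA q τ (β ∷⁺ L)

  data Name : Set where
    reg : Reg → Name
    loc : Loc → Name

  -- cur x is the current value x⃗.
  data XVar : Set where
    reg : Reg → XVar
    loc : Loc → XVar
    cur : Loc → XVar

  data BVar : Set where
    reg : Reg → BVar
    cur : Loc → BVar

  nameX : XVar → Name
  nameX (reg a) = reg a
  nameX (loc x) = loc x
  nameX (cur x) = loc x

  nameB : BVar → Name
  nameB (reg a) = reg a
  nameB (cur x) = loc x

  toX : ∀ {s} → Exp Reg s → Exp XVar s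
  toX = bind (var ∘ reg)

  toB : ∀ {s} → Exp Reg s → Exp BVar s
  toB = bind (var ∘ reg)

  infix 9 _[_≔_]ˣ _[_≔_]ᴮ _[_≔_]ᴵ _[_≔_]ᴬ

  _[_≔_]ˣ : ∀ {s} → Exp XVar s → Reg → Exp XVar nat → Exp XVar s
  E [ a ≔ F ]ˣ = bind σ E
    where
    σ : XVar → Exp XVar nat
    σ (reg b) = if does (b ≟ᴿ a) then F else var (reg b)
    σ (loc x) = var (loc x)
    σ (cur x) = var (cur x)

  _[_≔_]ᴮ : ∀ {s} → Exp BVar s → Reg → Exp BVar nat → Exp BVar s
  B [ a ≔ F ]ᴮ = bind σ B
    where
    σ : BVar → Exp BVar nat
    σ (reg b) = if does (b ≟ᴿ a) then F else var (reg b)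
    σ (cur x) = var (cur x)

  infixr 6 _⨾_

  data IAssn : Set where
    ⟦_⟧ : Exp XVar bool → IAssn
    _⨾_ : IAssn → IAssn → IAssn

  infix  8 _⋉_ _↑_ dist[_,_]≡_
  infixr 7 _∧_
  infixr 6 _∨_

  data Assn : Set where
    _⋉_         : Tid → IAssn → Assn
    C           : Loc → Assn
    dist[_,_]≡_ : Tid → Loc → ℕ → Assn
    ¬↑          : Tid → Loc → Assn  -- dist(τ,x) = n for some n ≢ 0
    at          : PC → Assn
    bexp        : Exp BVar bool → Assn
    _∧_         : Assn → Assn → Assn
    _∨_         : Assn → Assn → Assn

  _↑_ : Tid → Loc → Assn
  τ ↑ x = dist[ τ , x ]≡ 0

  varsᴵ : IAssn → List XVar
  varsᴵ ⟦ E ⟧   = vars E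
  varsᴵ (I ⨾ J) = varsᴵ I ++ varsᴵ J

  fvᴵ : IAssn → List Name
  fvᴵ = map nameX ∘ varsᴵ

  fv : Assn → List Name
  fv (_ ⋉ I)           = fvᴵ I
  fv (C x)             = loc x ∷ []
  fv (dist[ _ , x ]≡ _) = loc x ∷ []
  fv (¬↑ _ x)          = loc x ∷ []
  fv (at _)            = []
  fv (bexp B)          = map nameB (vars B)
  fv (φ ∧ ψ)           = fv φ ++ fv ψ
  fv (φ ∨ ψ)           = fv φ ++ fv ψ

  infix 4 _⊑_ _⋢_
  data _⊑_ (χ : Assn) : Assn → Set where
    here : χ ⊑ χ
    ∧ˡ   : ∀ {φ ψ} → χ ⊑ φ → χ ⊑ φ ∧ ψ
    ∧ʳ   : ∀ {φ ψ} → χ ⊑ ψ → χ ⊑ φ ∧ ψ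
    ∨ˡ   : ∀ {φ ψ} → χ ⊑ φ → χ ⊑ φ ∨ ψ
    ∨ʳ   : ∀ {φ ψ} → χ ⊑ ψ → χ ⊑ φ ∨ ψ

  _⋢_ : Assn → Assn → Set
  χ ⋢ φ = ¬ (χ ⊑ φ)

  _[_≔_]ᴵ : IAssn → Reg → Exp Reg nat → IAssn
  ⟦ E ⟧   [ a ≔ e ]ᴵ = ⟦ E [ a ≔ toX e ]ˣ ⟧
  (I ⨾ J) [ a ≔ e ]ᴵ = (I [ a ≔ e ]ᴵ) ⨾ (J [ a ≔ e ]ᴵ)

  _[_≔_]ᴬ : Assn → Reg → Exp Reg nat → Assn
  (τ ⋉ I)  [ a ≔ e ]ᴬ = τ ⋉ (I [ a ≔ e ]ᴵ)
  (bexp B) [ a ≔ e ]ᴬ = bexp (B [ a ≔ toB e ]ᴮ)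
  (φ ∧ ψ)  [ a ≔ e ]ᴬ = (φ [ a ≔ e ]ᴬ) ∧ (ψ [ a ≔ e ]ᴬ)
  (φ ∨ ψ)  [ a ≔ e ]ᴬ = (φ [ a ≔ e ]ᴬ) ∨ (ψ [ a ≔ e ]ᴬ)
  φ        [ a ≔ e ]ᴬ = φ

  envX : Store → PotStore → PotStore → XVar → ℕ
  envX γ β ω (reg a) = γ a
  envX γ β ω (loc x) = Entry.val (β x)
  envX γ β ω (cur x) = Entry.val (ω x)

  envB : Store → PotStore → BVar → ℕ
  envB γ ω (reg a) = γ a
  envB γ ω (cur x) = Entry.val (ω x)

  -- Current values are those of the last store ω of the whole list, also when
  -- a subassertion of I ⨾ J is evaluated in a segment of that list.
  Satᴵ : Store → PotStore → List PotStore → IAssn → Set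
  Satᴵ γ ω L ⟦ E ⟧   = All (λ β → eval (envX γ β ω) E ≡ true) L
  Satᴵ γ ω L (I ⨾ J) = ∃[ L₁ ] ∃[ L₂ ] L ≡ L₁ ++ L₂ × Satᴵ γ ω L₁ I × Satᴵ γ ω L₂ J

  -- #{ L[i](x) ∣ L[i](x) ≠ L[#L](x) }
  distance : Loc → List⁺ PotStore → ℕ
  distance x L =
    length (deduplicate _≟ᴱ_
      (filter (λ u → ¬? (u ≟ᴱ last L x)) (map (λ β → β x) (toList L))))

  Dist : PotMapping → Tid → Loc → ℕ → Set₁
  Dist ℬ τ x n =
    (∃[ L ] L ∈ ℬ τ × distance x L ≡ n) × (∀ L → L ∈ ℬ τ → distance x L ≤ n)

  CommonLast : PotMapping → PotStore → Set₁
  CommonLast ℬ ω = ∀ τ L → L ∈ ℬ τ → ∀ x → last L x ≡ ω x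

  Sat : Store → (Tid → PC) → PotMapping → Assn → Set₁
  Sat γ pc ℬ (τ ⋉ I)            = ∀ L → L ∈ ℬ τ → Satᴵ γ (last L) (toList L) I
  Sat γ pc ℬ (C x)              =
    ∀ τ L → L ∈ ℬ τ → All (λ β → Entry.flag (β x) ≡ true) (toList L)
  Sat γ pc ℬ (dist[ τ , x ]≡ n) = Dist ℬ τ x n
  Sat γ pc ℬ (¬↑ τ x)           = ∃[ n ] n ≢ 0 × Dist ℬ τ x n
  Sat γ pc ℬ (at l)             = Level.Lift (Level.suc 0ℓ) (∃[ τ ] pc τ ≡ l)
  Sat γ pc ℬ (bexp B)           =
    Σ[ ω ∈ PotStore ] CommonLast ℬ ω × eval (envB γ ω) B ≡ true
  Sat γ pc ℬ (φ ∧ ψ)            = Sat γ pc ℬ φ × Sat γ pc ℬ ψ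
  Sat γ pc ℬ (φ ∨ ψ)            = Sat γ pc ℬ φ ⊎ Sat γ pc ℬ ψ

  infix 4 _⊨_
  _⊨_ : State → Assn → Set₁
  state (pstate _ γ pc) q ⊨ φ = Sat γ pc (mapRA q) φ

  -- The postcondition may refer to next(l): for a test this depends on the
  -- branch taken, so it is supplied by the transition.
  infix 1 ⟪_⟫_↦_∶_⟪next_⟫ ⟪_⟫_↦_∶_⟪_⟫

  ⟪_⟫_↦_∶_⟪next_⟫ : Assn → Tid → PC → Cmd → (PC → Assn) → Set₁
  ⟪ φ ⟫ τ ↦ l ∶ c ⟪next ψ ⟫ =
    ∀ (P : Program) 𝐪 𝐪′ next → Reachable P 𝐪 → 𝐪 ⊨ φ →
    Step P 𝐪 (thread τ l c next) 𝐪′ → 𝐪′ ⊨ ψ next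

  ⟪_⟫_↦_∶_⟪_⟫ : Assn → Tid → PC → Cmd → Assn → Set₁
  ⟪ φ ⟫ τ ↦ l ∶ c ⟪ ψ ⟫ = ⟪ φ ⟫ τ ↦ l ∶ c ⟪next const ψ ⟫

{-# OPTIONS --safe #-}
module Submission where

-- Propagation only lets views grow, and every maximal run ends with each thread
-- at the newest message of each location.  Hence a list of thread τ visits, at
-- y, only messages from ν(τ)(y) on, some list visits all of them, and dist(τ,y)
-- and C(y) are determined by these messages; a write at x ≠ y leaves them alone.
-- For interval assertions, each list of a thread after the write embeds, off x,
-- into a list of that thread before it: where the new message m is propagated,
-- the thread instead catches up with the writer's view before the write, by
-- propagating the messages that this view points to.  Once another thread has
-- seen m, its list also embeds, off x, into one of the writer's lists before the
-- write; until then, it agrees with a list from before the write even at x.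

open import Defs
open import Level using (0ℓ; lift)
open import Data.Nat
open import Data.Nat.Properties
open import Data.Bool using (Bool; true; false; if_then_else_)
open import Data.Bool.Properties using (T-≡)
import Data.Fin.Properties as Finₚ
open import Data.List using (List; []; _∷_; _++_; map; length; allFin; cartesianProduct; initLast; _∷ʳ′_; deduplicate)
open import Data.List.Properties using (length-++; filter-none)
open import Data.List.NonEmpty using (List⁺; _∷_; _∷⁺_; toList; head; last)
open import Data.List.Relation.Unary.All using (All; []; _∷_; all?)
import Data.List.Relation.Unary.All as All
import Data.List.Relation.Unary.All.Properties as Allₚ
open import Data.List.Relation.Unary.Any using (here; there; any?)
import Data.List.Relation.Unary.Any as Any
open import Data.List.Relation.Unary.AllPairs using ([]; _∷_)
open import Data.List.Relation.Unary.Unique.Propositional using (Unique)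
open import Data.List.Relation.Unary.Unique.DecPropositional.Properties using (deduplicate-!)
open import Data.List.Membership.Propositional using (_∈_; _∉_; find; lose)
open import Data.List.Membership.Propositional.Properties
open import Data.Product using (_×_; _,_; ∃-syntax; proj₁; proj₂)
open import Data.Sum using (_⊎_; inj₁; inj₂; [_,_]′)
open import Data.Unit using (⊤; tt)
open import Function using (_∘_; id; const)
open import Function.Bundles using (_⇔_; mk⇔; module Equivalence)
open import Relation.Binary.Definitions using (DecidableEquality)
open import Relation.Binary.PropositionalEquality
open import Relation.Nullary using (Dec; yes; no; does; contradiction)
open import Relation.Nullary.Decidable using (map′; ¬?; _×-dec_; _→-dec_; _⊎-dec_)
open import Relation.Unary using (Pred; _∪_; ｛_｝)

-- Function update and finite lists.

module _ {A B : Set} (_≟_ : DecidableEquality A) (f : A → B) (a : A) (b : B) where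

  update-elim : ∀ {ℓ} (P : B → Set ℓ) a′ → (a′ ≡ a → P b) → (a′ ≢ a → P (f a′)) →
    P (update _≟_ f a b a′)
  update-elim P a′ same other with a′ ≟ a
  ... | yes eq = same eq
  ... | no neq = other neq

  update-same : update _≟_ f a b a ≡ b
  update-same = update-elim (_≡ b) a (const refl) (contradiction refl)

  update-other : ∀ {a′} → a′ ≢ a → update _≟_ f a b a′ ≡ f a′
  update-other {a′} neq = update-elim (_≡ f a′) a′ (λ eq → contradiction eq neq) (const refl)

last-∷⁺ : {A : Set} (x : A) (L : List⁺ A) → last (x ∷⁺ L) ≡ last L
last-∷⁺ x (y ∷ ys) with initLast ys
... | []      = refl
... | _ ∷ʳ′ _ = refl

unique-⊆⇒length≤ : {A : Set} {xs ys : List A} → Unique xs → (∀ {z} → z ∈ xs → z ∈ ys) →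
  length xs ≤ length ys
unique-⊆⇒length≤ [] sub = z≤n
unique-⊆⇒length≤ {xs = x ∷ xs} (x∉xs ∷ uniq) sub with ∈-∃++ (sub (here refl))
... | ys , zs , refl = begin
    suc (length xs)             ≤⟨ s≤s (unique-⊆⇒length≤ uniq shrink) ⟩
    suc (length (ys ++ zs))     ≡⟨ cong suc (length-++ ys) ⟩
    suc (length ys + length zs) ≡⟨ sym (+-suc (length ys) (length zs)) ⟩
    length ys + suc (length zs) ≡⟨ sym (length-++ ys) ⟩
    length (ys ++ x ∷ zs)       ∎
  where
  open ≤-Reasoning
  shrink : ∀ {z} → z ∈ xs → z ∈ ys ++ zs
  shrink z∈ with ∈-++⁻ ys (sub (there z∈))
  ... | inj₁ z∈ys         = ∈-++⁺ˡ z∈ys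
  ... | inj₂ (here refl)  = contradiction refl (All.lookup x∉xs z∈)
  ... | inj₂ (there z∈zs) = ∈-++⁺ʳ ys z∈zs

-- Embeddings of lists.

-- Interval assertions are inherited by embedded lists: omitting or repeating
-- stores does not affect them.
data Emb {A : Set} (_∼_ : A → A → Set) : List A → List A → Set where
  []   : ∀ {ys} → Emb _∼_ [] ys
  keep : ∀ {x y xs ys} → x ∼ y → Emb _∼_ xs (y ∷ ys) → Emb _∼_ (x ∷ xs) (y ∷ ys)
  drop : ∀ {y xs ys} → Emb _∼_ xs ys → Emb _∼_ xs (y ∷ ys)

module _ {A : Set} {_∼_ : A → A → Set} where

  Emb-refl : (∀ x → x ∼ x) → ∀ xs → Emb _∼_ xs xs
  Emb-refl r []       = []
  Emb-refl r (x ∷ xs) = keep (r x) (drop (Emb-refl r xs))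

  Emb-All : {P Q : A → Set} → (∀ {x y} → x ∼ y → P y → Q x) →
    ∀ {xs ys} → Emb _∼_ xs ys → All P ys → All Q xs
  Emb-All f []         _          = []
  Emb-All f (keep r e) ps@(p ∷ _) = f r p ∷ Emb-All f e ps
  Emb-All f (drop e)   (_ ∷ ps)   = Emb-All f e ps

  -- Matching is monotone, so the elements matched within `ys` come first. An element matched again
  -- to the same `y` stays on the side of that `y`.
  Emb-split : ∀ ys {zs xs} → Emb _∼_ xs (ys ++ zs) →
    ∃[ xs₁ ] ∃[ xs₂ ] xs ≡ xs₁ ++ xs₂ × Emb _∼_ xs₁ ys × Emb _∼_ xs₂ zs
  Emb-split []       e  = [] , _ , refl , [] , e
  Emb-split (_ ∷ _)  [] = [] , [] , refl , [] , []
  Emb-split (y ∷ ys) (keep r e) with Emb-split (y ∷ ys) e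
  ... | _ , _ , refl , e₁ , e₂ = _ , _ , refl , keep r e₁ , e₂
  Emb-split (y ∷ ys) (drop e) with Emb-split ys e
  ... | _ , _ , refl , e₁ , e₂ = _ , _ , refl , drop e₁ , e₂

-- For (St-Other): the jump is the point where the observing thread sees the new
-- message, and Q says that what follows embeds into a list of the writing thread.
data Emb² {A : Set} (_∼_ _≈_ : A → A → Set) (Q : List A → Set₁) :
          List A → List A → Set₁ where
  []   : ∀ {ys} → Emb² _∼_ _≈_ Q [] ys
  keep : ∀ {x y xs ys} → x ∼ y → Emb² _∼_ _≈_ Q xs (y ∷ ys) →
         Emb² _∼_ _≈_ Q (x ∷ xs) (y ∷ ys)
  drop : ∀ {y xs ys} → Emb² _∼_ _≈_ Q xs ys → Emb² _∼_ _≈_ Q xs (y ∷ ys)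
  jump : ∀ {xs ys} → Emb _≈_ xs ys → Q xs → Emb² _∼_ _≈_ Q xs ys

module _ {A : Set} {_∼_ _≈_ : A → A → Set} {Q : List A → Set₁}
         (∼⇒≈ : ∀ {x y} → x ∼ y → x ≈ y) where

  Emb²⇒Emb : ∀ {xs ys} → Emb² _∼_ _≈_ Q xs ys → Emb _≈_ xs ys
  Emb²⇒Emb []         = []
  Emb²⇒Emb (keep r e) = keep (∼⇒≈ r) (Emb²⇒Emb e)
  Emb²⇒Emb (drop e)   = drop (Emb²⇒Emb e)
  Emb²⇒Emb (jump e _) = e

  -- A jump before `ys` is exhausted discards the rest of the embedding: all that follows is
  -- described by `Q`. A later jump is forgotten, which leaves an ordinary embedding into `zs`.
  Emb²-split : ∀ ys {zs xs} → Emb² _∼_ _≈_ Q xs (ys ++ zs) →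
    ∃[ xs₁ ] ∃[ xs₂ ] xs ≡ xs₁ ++ xs₂ × Emb _∼_ xs₁ ys × (Emb _≈_ xs₂ zs ⊎ Q xs₂)
  Emb²-split []       e  = [] , _ , refl , [] , inj₁ (Emb²⇒Emb e)
  Emb²-split (_ ∷ _)  [] = [] , [] , refl , [] , inj₁ []
  Emb²-split (y ∷ ys) (keep r e) with Emb²-split (y ∷ ys) e
  ... | _ , _ , refl , e₁ , e₂ = _ , _ , refl , keep r e₁ , e₂
  Emb²-split (y ∷ ys) (drop e) with Emb²-split ys e
  ... | _ , _ , refl , e₁ , e₂ = _ , _ , refl , drop e₁ , e₂
  Emb²-split (y ∷ ys) (jump _ q) = [] , _ , refl , [] , inj₂ q

-- Evaluation of expressions.

eval-cong : ∀ {A s} {ρ ρ′ : A → ℕ} (E : Exp A s) →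
  (∀ {v} → v ∈ vars E → ρ v ≡ ρ′ v) → eval ρ E ≡ eval ρ′ E
eval-cong (var a)      h = h (here refl)
eval-cong (lit _)      h = refl
eval-cong (op₁ f E)    h = cong f (eval-cong E h)
eval-cong (op₂ f E E′) h =
  cong₂ f (eval-cong E (h ∘ ∈-++⁺ˡ)) (eval-cong E′ (h ∘ ∈-++⁺ʳ (vars E)))

eval-bind : ∀ {A B s} {ρ : A → ℕ} {ρ′ : B → ℕ} (σ : A → Exp B nat) →
  (∀ a → eval ρ′ (σ a) ≡ ρ a) → (E : Exp A s) → eval ρ′ (bind σ E) ≡ eval ρ E
eval-bind σ h (var a)      = h a
eval-bind σ h (lit _)      = refl
eval-bind σ h (op₁ f E)    = cong f (eval-bind σ h E)
eval-bind σ h (op₂ f E E′) = cong₂ f (eval-bind σ h E) (eval-bind σ h E′)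

-- Flags are given only up to logical equivalence with `Covered`; this turns such a description into
-- an equation.
bool-iff : ∀ {b c : Bool} → (b ≡ true → c ≡ true) → (c ≡ true → b ≡ true) → b ≡ c
bool-iff {true}  {_}     f g = sym (f refl)
bool-iff {false} {true}  f g = g refl
bool-iff {false} {false} f g = refl

module Soundness (S : Signature) where
  open Piccolo S
  open Message using (val; ts; tid; view) renaming (loc to at-loc)

  -- Invariants of memories and views.

  Memory : Set₁
  Memory = Pred Message 0ℓ

  -- Causality: a view that contains m also contains what m's writer had seen.
  record GoodView (M : Memory) (V : View) : Set where
    field
      current : ∀ x → ∃[ m ] M m × at-loc m ≡ x × ts m ≡ V x
      causal  : ∀ m → M m → ts m ≡ V (at-loc m) → ∀ z → view m z ≤ V z

  -- `Loc` may be infinite, so the initial messages need not form a list. Messages with a positive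
  -- timestamp do, and only these can ever be propagated.
  record GoodMem (M : Memory) : Set where
    field
      written   : List Message
      cover     : ∀ m → M m → ts m ≡ 0 ⊎ m ∈ written
      sound     : ∀ {m} → m ∈ written → M m
      unique    : ∀ {m m′} → M m → M m′ → at-loc m ≡ at-loc m′ → ts m ≡ ts m′ → m ≡ m′
      view-ts   : ∀ {m} → M m → view m (at-loc m) ≡ ts m
      view-good : ∀ {m} → M m → GoodView M (view m)

  GoodViews : Memory → (Tid → View) → Set
  GoodViews M ν = ∀ σ → GoodView M (ν σ)

  -- At each location the join equals one of the two views, which supplies the message there and its
  -- causality.
  good-⊔ : ∀ {M V V′} → GoodView M V → GoodView M V′ → GoodView M (V ⊔ⱽ V′)
  good-⊔ {M} {V} {V′} g g′ = record { current = cur′ ; causal = cau }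
    where
    open GoodView
    cur′ : ∀ x → ∃[ m ] M m × at-loc m ≡ x × ts m ≡ V x ⊔ V′ x
    cur′ x with ⊔-sel (V x) (V′ x)
    ... | inj₁ eq rewrite eq = current g x
    ... | inj₂ eq rewrite eq = current g′ x
    cau : ∀ m → M m → ts m ≡ V (at-loc m) ⊔ V′ (at-loc m) → ∀ z → view m z ≤ V z ⊔ V′ z
    cau m Mm e z with ⊔-sel (V (at-loc m)) (V′ (at-loc m))
    ... | inj₁ eq = m≤n⇒m≤n⊔o (V′ z) (causal g m Mm (trans e eq) z)
    ... | inj₂ eq = m≤n⇒m≤o⊔n (V z) (causal g′ m Mm (trans e eq) z)

  good-update : ∀ {M ν V} σ → GoodViews M ν → GoodView M V → GoodViews M (ν [ σ ↦ V ]ᵀ)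
  good-update {M} {ν} σ gn gV σ′ =
    update-elim Finₚ._≟_ ν σ _ (GoodView M) σ′ (const gV) (const (gn σ′))

  good-prop : ∀ {M ν m} σ → GoodMem M → GoodViews M ν → M m →
    GoodViews M (ν [ σ ↦ ν σ ⊔ⱽ view m ]ᵀ)
  good-prop σ gm gn Mm = good-update σ gn (good-⊔ (gn σ) (GoodMem.view-good gm Mm))

  view-grows : ∀ (ν : Tid → View) σ V τ z → ν τ z ≤ (ν [ σ ↦ ν σ ⊔ⱽ V ]ᵀ) τ z
  view-grows ν σ V τ z = update-elim Finₚ._≟_ ν σ _ (λ U → ν τ z ≤ U z) τ
    (λ { refl → m≤m⊔n (ν σ z) (V z) }) (const ≤-refl)

  -- Entries occurring in the lists of a potential.

  -- `Covered` inspects only the messages, so the views are a dummy, and `Cov M` unfolds to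
  -- coveredness in any state with memory `M`.
  Cov : Memory → Message → Set
  Cov M = Covered ⟨ M , const (const 0) ⟩

  EntryOf : Memory → Message → Entry → Set
  EntryOf M m u = Entry.val u ≡ val m × Entry.tid u ≡ tid m
    × (Entry.flag u ≡ true ⇔ Cov M m) × Entry.ts u ≡ ts m

  entryOf-unique : ∀ {M m u u′} → EntryOf M m u → EntryOf M m u′ → u ≡ u′
  entryOf-unique {u = entry v τ f t} {entry v′ τ′ f′ t′}
    (refl , refl , F , refl) (refl , refl , F′ , refl) =
    cong (λ f → entry v τ f t)
      (bool-iff (Equivalence.from F′ ∘ Equivalence.to F) (Equivalence.from F ∘ Equivalence.to F′))

  -- What a thread with timestamp `n` for `y` may still display there: by `run-entries` its lists
  -- contain no other entries at `y`, and by `full-run` one list contains all of these.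
  EntryAt : Memory → ℕ → Loc → Entry → Set
  EntryAt M n y u = ∃[ m ] M m × at-loc m ≡ y × n ≤ ts m × EntryOf M m u

  Newest : Memory → Message → Set
  Newest M m = ∀ m′ → M m′ → at-loc m′ ≡ at-loc m → ts m′ ≤ ts m

  EntryMax : Memory → Loc → Entry → Set
  EntryMax M y u = ∃[ m ] M m × at-loc m ≡ y × Newest M m × EntryOf M m u

  run-entries : ∀ {M ν τ L} y → mapRA ⟨ M , ν ⟩ τ L →
    All (λ β → EntryAt M (ν τ y) y (β y)) (toList L)
  run-entries {M} {ν} {τ} y (end δ _) with δ y
  ... | m , (Mm , eq) , t , e = (m , Mm , eq , ≤-reflexive (sym t) , e) ∷ []
  run-entries {M} {ν} {τ} y (cons δ (prop {m = m₁} σ _ _) h) with δ y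
  ... | m , (Mm , eq) , t , e = (m , Mm , eq , ≤-reflexive (sym t) , e)
    ∷ All.map (λ (m′ , Mm′ , eq′ , t′ , e′) →
        m′ , Mm′ , eq′ , ≤-trans (view-grows ν σ (view m₁) τ y) t′ , e′)
      (run-entries y h)

  -- A list ends where no propagation is enabled, whereas a message newer than the one in the
  -- thread's view would enable one.
  run-last : ∀ {M ν τ L} y → mapRA ⟨ M , ν ⟩ τ L → EntryMax M y (last L y)
  run-last {M} {ν} {τ} y (end δ final) with δ y
  ... | m , (Mm , refl) , t , e = m , Mm , refl , newest , e
    where
    newest : Newest M m
    newest m′ Mm′ eq with ts m′ ≤? ts m
    ... | yes le = le
    ... | no gt  = contradiction
      (prop τ Mm′ (subst (_< ts m′) (trans t (cong (ν τ) (sym eq))) (≰⇒> gt)))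
      (final _)
  run-last y (cons {β = β} {L = L} δ (prop _ _ _) h)
    rewrite last-∷⁺ β L = run-last y h

  run-head : ∀ {q τ L} → mapRA q τ L → IsΔ τ q (head L)
  run-head (end δ _)    = δ
  run-head (cons δ _ _) = δ

  -- Construction of lists.

  module Runs {M : Memory} (gm : GoodMem M) where
    open GoodMem gm

    newest-unique : ∀ {m m′} → M m → M m′ → at-loc m ≡ at-loc m′ →
      Newest M m → Newest M m′ → m ≡ m′
    newest-unique Mm Mm′ eq n n′ = unique Mm Mm′ eq (≤-antisym (n′ _ Mm eq) (n _ Mm′ (sym eq)))

    -- Together with `run-last`: the last stores of all lists, whatever the thread, agree at `y`.
    entryMax-unique : ∀ {y u u′} → EntryMax M y u → EntryMax M y u′ → u ≡ u′
    entryMax-unique (m , Mm , eq , n , e) (m′ , Mm′ , eq′ , n′ , e′)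
      with refl ← newest-unique Mm Mm′ (trans eq (sym eq′)) n n′ = entryOf-unique {M} {m} e e′

    -- Searching `written` suffices: a message with timestamp 0 is never later than `m` and never
    -- its successor.
    cov? : ∀ m → Dec (Cov M m)
    cov? m = newest? ⊎-dec successor?
      where
      newest? : Dec (∀ m′ → M m′ × at-loc m′ ≡ at-loc m → ts m′ ≤ ts m)
      newest? = map′
        (λ le m′ (Mm′ , eq) →
          [ (λ z → ≤-trans (≤-reflexive z) z≤n) , (λ m′∈ → All.lookup le m′∈ eq) ]′ (cover m′ Mm′))
        (λ le → All.tabulate (λ {m′} m′∈ eq → le m′ (sound m′∈ , eq)))
        (all? (λ m′ → (at-loc m′ ≟ᴸ at-loc m) →-dec (ts m′ ≤? ts m)) written)
      successor? : Dec (∃[ m′ ] (M m′ × at-loc m′ ≡ at-loc m) × ts m′ ≡ ts m + 1)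
      successor? = map′
        found
        (λ (m′ , (Mm′ , eq) , t) →
          [ (λ z → contradiction (trans (trans (+-comm 1 (ts m)) (sym t)) z) λ ())
          , (λ m′∈ → lose m′∈ (eq , t)) ]′ (cover m′ Mm′))
        (any? (λ m′ → (at-loc m′ ≟ᴸ at-loc m) ×-dec (ts m′ ≟ ts m + 1)) written)
        where
        found : Any.Any (λ m′ → at-loc m′ ≡ at-loc m × ts m′ ≡ ts m + 1) written →
          ∃[ m′ ] (M m′ × at-loc m′ ≡ at-loc m) × ts m′ ≡ ts m + 1
        found p with find p
        ... | m′ , m′∈ , eq , t = m′ , (sound m′∈ , eq) , t

    entry-exists : ∀ m → ∃[ u ] EntryOf M m u
    entry-exists m = entry (val m) (tid m) (does (cov? m)) (ts m)
      , refl , refl , does-⇔ (cov? m) , refl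
      where
      does-⇔ : {A : Set} (d : Dec A) → does d ≡ true ⇔ A
      does-⇔ (yes a) = mk⇔ (const a) (const refl)
      does-⇔ (no ¬a) = mk⇔ (λ ()) (λ a → contradiction a ¬a)

    Δ-exists : ∀ {ν τ} → GoodViews M ν → ∃[ β ] IsΔ τ ⟨ M , ν ⟩ β
    Δ-exists {ν} {τ} gn =
        (λ x → proj₁ (entry-exists (proj₁ (GoodView.current (gn τ) x))))
      , (λ x → let m , Mm , eq , t = GoodView.current (gn τ) x in
          m , (Mm , eq) , t , proj₂ (entry-exists m))

    -- Propagation terminates: only finitely many pairs of a thread and a message can be propagated,
    -- and each at most once, since the view of a message contains its own timestamp and views never
    -- shrink.
    run-exists : ∀ {ν} → GoodViews M ν → ∀ τ → ∃[ L ] mapRA ⟨ M , ν ⟩ τ L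
    run-exists gn τ = go (cartesianProduct (allFin _) written)
      (λ p∈ → sound (proj₂ (∈-cartesianProduct⁻ (allFin _) written p∈))) gn
      (λ σ m Mm lt → ∈-cartesianProduct⁺ (∈-allFin σ)
        ([ (λ z → contradiction (subst (_ <_) z lt) λ ()) , id ]′ (cover m Mm)))
      where
      -- ps contains all pairs (σ , m) such that m can still be propagated to σ.
      go : ∀ ps → (∀ {p} → p ∈ ps → M (proj₂ p)) → ∀ {ν} → GoodViews M ν →
        (∀ σ m → M m → ν σ (at-loc m) < ts m → (σ , m) ∈ ps) → ∃[ L ] mapRA ⟨ M , ν ⟩ τ L
      go [] _ gn todo = _ , end (proj₂ (Δ-exists gn))
        λ { _ (prop σ Mm lt) → contradiction (todo σ _ Mm lt) λ () }
      go ((σ , m) ∷ ps) ok {ν} gn todo with ν σ (at-loc m) <? ts m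
      ... | no ≮ = go ps (ok ∘ there) gn λ σ′ m′ Mm′ lt → skip-head lt (todo σ′ m′ Mm′ lt)
        where
        skip-head : ∀ {σ′ m′} → ν σ′ (at-loc m′) < ts m′ → (σ′ , m′) ∈ (σ , m) ∷ ps → (σ′ , m′) ∈ ps
        skip-head lt (here refl) = contradiction lt ≮
        skip-head lt (there p∈)  = p∈
      ... | yes lt₀ = _ , cons (proj₂ (Δ-exists gn)) (prop σ Mm lt₀) (proj₂ rest)
        where
        Mm : M m
        Mm = ok (here refl)
        ν′ : Tid → View
        ν′ = ν [ σ ↦ ν σ ⊔ⱽ view m ]ᵀ
        seen : ts m ≤ ν′ σ (at-loc m)
        seen = begin
          ts m                              ≡⟨ sym (view-ts Mm) ⟩
          view m (at-loc m)                 ≤⟨ m≤n⊔m (ν σ (at-loc m)) _ ⟩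
          (ν σ ⊔ⱽ view m) (at-loc m)        ≡⟨ cong (λ V → V (at-loc m)) (sym (update-same Finₚ._≟_ ν σ _)) ⟩
          ν′ σ (at-loc m)                   ∎
          where open ≤-Reasoning
        skip-head : ∀ {σ′ m′} → ν′ σ′ (at-loc m′) < ts m′ → (σ′ , m′) ∈ (σ , m) ∷ ps → (σ′ , m′) ∈ ps
        skip-head lt (here refl) = contradiction seen (<⇒≱ lt)
        skip-head lt (there p∈)  = p∈
        rest = go ps (ok ∘ there) (good-prop σ gm gn Mm) λ σ′ m′ Mm′ lt → skip-head lt
          (todo σ′ m′ Mm′ (≤-<-trans (view-grows ν σ (view m) σ′ (at-loc m′)) lt))

    ts-bound : ∃[ N ] (∀ m → M m → ts m ≤ N)
    ts-bound = sumTs written , λ m Mm →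
      [ (λ z → ≤-trans (≤-reflexive z) z≤n) , bounded written ]′ (cover m Mm)
      where
      sumTs : List Message → ℕ
      sumTs []       = 0
      sumTs (m ∷ ms) = ts m + sumTs ms
      bounded : ∀ ms {m} → m ∈ ms → ts m ≤ sumTs ms
      bounded (m ∷ ms) (here refl) = m≤m+n (ts m) _
      bounded (m ∷ ms) (there m∈)  = ≤-trans (bounded ms m∈) (m≤n+m _ (ts m))

    -- The messages at y are propagated to τ one by one, in the order of their timestamps.
    full-run : ∀ {ν} → GoodViews M ν → ∀ τ y →
      ∃[ L ] mapRA ⟨ M , ν ⟩ τ L × (∀ {u} → EntryAt M (ν τ y) y u → u ∈ map (λ β → β y) (toList L))
    full-run {ν₀} gn₀ τ y =
      go (proj₁ ts-bound) gn₀ (ν₀ τ y) ≤-refl (λ _ _ _ le ge → ≤-antisym ge le)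
        (λ m Mm _ → ≤-trans (proj₂ ts-bound m Mm) (m≤n+m _ (ν₀ τ y)))
      where
      visit : ∀ ν {β} → IsΔ τ ⟨ M , ν ⟩ β → ∀ {m u} → M m → at-loc m ≡ y → ts m ≡ ν τ y →
        EntryOf M m u → u ≡ β y
      visit ν δ Mm eq t e with δ y
      ... | m′ , (Mm′ , eq′) , t′ , e′
        with refl ← unique Mm Mm′ (trans eq (sym eq′)) (trans t (sym t′)) = entryOf-unique {M} {m′} e e′

      -- At `y`, no message lies strictly above the view of `τ` and at or below `n`, and none lies
      -- above `n + k`. Thus `k` counts the timestamps still to be examined.
      go : ∀ k {ν} → GoodViews M ν → ∀ n → ν τ y ≤ n →
        (∀ m → M m → at-loc m ≡ y → ν τ y ≤ ts m → ts m ≤ n → ts m ≡ ν τ y) →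
        (∀ m → M m → at-loc m ≡ y → ts m ≤ n + k) →
        ∃[ L ] mapRA ⟨ M , ν ⟩ τ L
          × (∀ {u} → EntryAt M (ν τ y) y u → u ∈ map (λ β → β y) (toList L))
      go zero {ν} gn n _ gap bound with run-exists gn τ
      ... | L , h = L , h , λ (m , Mm , eq , le , e) →
        here (visit ν (run-head h) Mm eq
          (gap m Mm eq le (subst (ts m ≤_) (+-identityʳ n) (bound m Mm eq))) e)
      go (suc k) {ν} gn n le₀ gap bound
        with any? (λ m → (at-loc m ≟ᴸ y) ×-dec (ts m ≟ suc n)) written
      ... | no none = go k gn (suc n) (m≤n⇒m≤1+n le₀) gap′
              (λ m Mm eq → subst (ts m ≤_) (+-suc n k) (bound m Mm eq))
        where
        gap′ : ∀ m → M m → at-loc m ≡ y → ν τ y ≤ ts m → ts m ≤ suc n → ts m ≡ ν τ y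
        gap′ m Mm eq ge le with m≤n⇒m<n∨m≡n le
        ... | inj₁ (s≤s lt) = gap m Mm eq ge lt
        ... | inj₂ t = [ (λ z → contradiction (trans (sym t) z) λ ())
                       , (λ m∈ → contradiction (lose m∈ (eq , t)) none) ]′ (cover m Mm)
      ... | yes some with find some
      ...   | m₁ , m₁∈ , refl , t₁ = _ , cons δ (prop τ Mm₁ lt₁) (proj₁ (proj₂ rest)) , visits
        where
        Mm₁ = sound m₁∈
        lt₁ : ν τ y < ts m₁
        lt₁ = subst (ν τ y <_) (sym t₁) (s≤s le₀)
        δ = proj₂ (Δ-exists {τ = τ} gn)
        ν′ : Tid → View
        ν′ = ν [ τ ↦ ν τ ⊔ⱽ view m₁ ]ᵀ
        now : ν′ τ y ≡ suc n
        now = begin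
          ν′ τ y             ≡⟨ cong (λ V → V y) (update-same Finₚ._≟_ ν τ _) ⟩
          ν τ y ⊔ view m₁ y  ≡⟨ cong (ν τ y ⊔_) (trans (view-ts Mm₁) t₁) ⟩
          ν τ y ⊔ suc n      ≡⟨ m≤n⇒m⊔n≡n (m≤n⇒m≤1+n le₀) ⟩
          suc n              ∎
          where open ≡-Reasoning
        rest = go k (good-prop τ gm gn Mm₁) (suc n) (≤-reflexive now)
          (λ m _ _ ge le → ≤-antisym (≤-trans le (≤-reflexive (sym now))) ge)
          (λ m Mm eq → subst (ts m ≤_) (+-suc n k) (bound m Mm eq))
        visits : ∀ {u} → EntryAt M (ν τ y) y u → u ∈ _
        visits (m , Mm , eq , ge , e) with ts m ≤? n
        ... | yes le = here (visit ν δ Mm eq (gap m Mm eq ge le) e)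
        ... | no gt  = there (proj₂ (proj₂ rest)
          (m , Mm , eq , ≤-trans (≤-reflexive now) (≰⇒> gt) , e))

    -- In the construction below, `L₀` is `L` behind some further stores; only the consequence for
    -- embeddings is recorded.
    Extends : (ν ν′ : Tid → View) → Tid → Set₁
    Extends ν ν′ σ = ∀ L → mapRA ⟨ M , ν′ ⟩ σ L → ∃[ L₀ ] mapRA ⟨ M , ν ⟩ σ L₀
      × (∀ {_∼_ : PotStore → PotStore → Set} {K} → Emb _∼_ K (toList L) → Emb _∼_ K (toList L₀))

    -- By causality, propagating the messages that U points to does not lead beyond U.
    catch-up : ∀ {U} → GoodView M U → ∀ {ν} → GoodViews M ν → ∀ σ →
      ∃[ ν′ ] GoodViews M ν′ × (∀ z → ν′ σ z ≡ ν σ z ⊔ U z) × Extends ν ν′ σ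
    catch-up {U} gU {ν} gn σ =
      let ν′ , gn′ , lo , hi , reach , ext = go written sound gn in
      ν′ , gn′ , (λ z → ≤-antisym (hi z) (⊔-lub (lo z) (reaches ν′ reach z))) , ext
      where
      go : ∀ ms → (∀ {m} → m ∈ ms → M m) → ∀ {ν} → GoodViews M ν →
        ∃[ ν′ ] GoodViews M ν′ × (∀ z → ν σ z ≤ ν′ σ z) × (∀ z → ν′ σ z ≤ ν σ z ⊔ U z)
          × (∀ {m} → m ∈ ms → ts m ≡ U (at-loc m) → ts m ≤ ν′ σ (at-loc m))
          × Extends ν ν′ σ
      go [] _ {ν} gn = ν , gn , (λ _ → ≤-refl) , (λ z → m≤m⊔n (ν σ z) (U z)) , (λ ()) ,
        λ L h → L , h , id
      go (m ∷ ms) ok {ν} gn with ts m ≟ U (at-loc m) | ν σ (at-loc m) <? ts m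
      ... | no neq | _ with go ms (ok ∘ there) gn
      ...   | ν′ , gn′ , lo , hi , reach , ext =
        ν′ , gn′ , lo , hi
          , (λ { (here refl) eq → contradiction eq neq ; (there m∈) → reach m∈ }) , ext
      go (m ∷ ms) ok {ν} gn | yes _ | no ≮ with go ms (ok ∘ there) gn
      ...   | ν′ , gn′ , lo , hi , reach , ext =
        ν′ , gn′ , lo , hi
          , (λ { (here refl) _ → ≤-trans (≮⇒≥ ≮) (lo _) ; (there m∈) → reach m∈ }) , ext
      go (m ∷ ms) ok {ν} gn | yes eq | yes lt
        with go ms (ok ∘ there) (good-prop σ gm gn (ok (here refl)))
      ...   | ν′ , gn′ , lo , hi , reach , ext =
        ν′ , gn′ , (λ z → ≤-trans (m≤m⊔n (ν σ z) _) (lo₁ z))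
          , (λ z → ≤-trans (hi z) (subst (λ V → V z ⊔ U z ≤ ν σ z ⊔ U z) (sym ν₁≡) (hi₁ z)))
          , (λ { (here refl) _ → ≤-trans (≤-reflexive (sym (view-ts Mm)))
                   (≤-trans (m≤n⊔m (ν σ (at-loc m)) _) (lo₁ (at-loc m)))
               ; (there m∈) → reach m∈ })
          , λ L h → let L₀ , h₀ , e = ext L h in
              _ , cons (proj₂ (Δ-exists gn)) (prop σ Mm lt) h₀ , λ emb → drop (e emb)
        where
        Mm = ok (here refl)
        ν₁≡ = update-same Finₚ._≟_ ν σ (ν σ ⊔ⱽ view m)
        lo₁ : ∀ z → ν σ z ⊔ view m z ≤ ν′ σ z
        lo₁ z = subst (λ V → V z ≤ ν′ σ z) ν₁≡ (lo z)
        hi₁ : ∀ z → ν σ z ⊔ view m z ⊔ U z ≤ ν σ z ⊔ U z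
        hi₁ z = ⊔-lub (⊔-monoʳ-≤ (ν σ z) (GoodView.causal gU m Mm eq z)) (m≤n⊔m (ν σ z) (U z))
      reaches : ∀ ν′ → (∀ {m} → m ∈ written → ts m ≡ U (at-loc m) → ts m ≤ ν′ σ (at-loc m)) →
        ∀ z → U z ≤ ν′ σ z
      reaches ν′ reach z with GoodView.current gU z
      ... | m , Mm , refl , t = subst (_≤ ν′ σ z) t
        ([ (λ t₀ → ≤-trans (≤-reflexive t₀) z≤n) , (λ m∈ → reach m∈ t) ]′ (cover m Mm))

  -- Distances and what assertions reveal about the memory.

  -- Equal last entries make both filters discard the same entry, so inclusion survives filtering
  -- and bounds the number of distinct entries.
  distance-mono : ∀ y L L′ → (∀ {u} → u ∈ map (λ β → β y) (toList L) → u ∈ map (λ β → β y) (toList L′)) →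
    last L y ≡ last L′ y → distance y L ≤ distance y L′
  distance-mono y L L′ sub eq = unique-⊆⇒length≤ (deduplicate-! _≟ᴱ_ _) λ z∈ →
    let z∈map , z≢ = ∈-filter⁻ (λ u → ¬? (u ≟ᴱ last L y)) (∈-deduplicate⁻ _≟ᴱ_ _ z∈) in
    ∈-deduplicate⁺ _≟ᴱ_ (∈-filter⁺ (λ u → ¬? (u ≟ᴱ last L′ y)) (sub z∈map) (subst (_ ≢_) eq z≢))

  distance≡0⇒constant : ∀ y L → distance y L ≡ 0 →
    ∀ {u} → u ∈ map (λ β → β y) (toList L) → u ≡ last L y
  distance≡0⇒constant y L d {u} u∈ with u ≟ᴱ last L y
  ... | yes eq = eq
  ... | no neq = contradiction d (∈⇒length≢0
          (∈-deduplicate⁺ _≟ᴱ_ (∈-filter⁺ (λ u → ¬? (u ≟ᴱ last L y)) u∈ neq)))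
    where
    ∈⇒length≢0 : {A : Set} {z : A} {zs : List A} → z ∈ zs → length zs ≢ 0
    ∈⇒length≢0 (here _)  ()
    ∈⇒length≢0 (there _) ()

  constant⇒distance≡0 : ∀ y L → All (λ β → β y ≡ last L y) (toList L) → distance y L ≡ 0
  constant⇒distance≡0 y L const-y =
    cong (length ∘ deduplicate _≟ᴱ_)
      (filter-none (λ u → ¬? (u ≟ᴱ last L y)) (Allₚ.map⁺ (All.map (λ eq neq → neq eq) const-y)))

  run-entries-∈ : ∀ {M ν τ L} y → mapRA ⟨ M , ν ⟩ τ L →
    ∀ {u} → u ∈ map (λ β → β y) (toList L) → EntryAt M (ν τ y) y u
  run-entries-∈ y h u∈ with ∈-map⁻ _ u∈
  ... | β , β∈ , refl = All.lookup (run-entries y h) β∈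

  module Potential {M ν} (gm : GoodMem M) (gn : GoodViews M ν) where
    open Runs gm

    common-last : ∃[ ω ] CommonLast (mapRA ⟨ M , ν ⟩) ω × (∀ y → EntryMax M y (ω y))
    common-last with run-exists gn T₀
    ... | L₀ , h₀ = last L₀
      , (λ τ L h y → entryMax-unique (run-last y h) (run-last y h₀)) , (λ y → run-last y h₀)

    -- `CommonLast` is not vacuous, because a list exists; its last store then fixes `ω`.
    commonLast⇒entryMax : ∀ {ω} → CommonLast (mapRA ⟨ M , ν ⟩) ω → ∀ y → EntryMax M y (ω y)
    commonLast⇒entryMax common y with run-exists gn T₀
    ... | L₀ , h₀ = subst (EntryMax M y) (common T₀ L₀ h₀ y) (run-last y h₀)

    -- The list from `full-run` displays every entry still possible, so its flags speak for all of
    -- them.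
    C⇒flag : ∀ {y} → (∀ τ L → mapRA ⟨ M , ν ⟩ τ L → All (λ β → Entry.flag (β y) ≡ true) (toList L)) →
      ∀ {σ u} → EntryAt M (ν σ y) y u → Entry.flag u ≡ true
    C⇒flag {y} covered {σ} ea with full-run gn σ y
    ... | L , h , visits with ∈-map⁻ _ (visits ea)
    ...   | β , β∈ , refl = All.lookup (covered σ L h) β∈

    -- With distance 0 the first entry equals the last one. The first carries the timestamp of the
    -- view of `τ`, the last that of the newest message.
    up-to-date : ∀ {τ y} → Dist (mapRA ⟨ M , ν ⟩) τ y 0 → ∀ {m} → M m → at-loc m ≡ y → ts m ≤ ν τ y
    up-to-date {τ} {y} ((L , h , d) , _) {m} Mm eq
      with run-last y h | run-head h y
    ... | m₁ , _ , refl , n₁ , (_ , _ , _ , t₁) | m₂ , _ , t₂ , (_ , _ , _ , t₂′) = begin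
        ts m                   ≤⟨ n₁ m Mm eq ⟩
        ts m₁                  ≡⟨ sym t₁ ⟩
        Entry.ts (last L y)    ≡⟨ cong Entry.ts (sym (distance≡0⇒constant y L d (here refl))) ⟩
        Entry.ts (head L y)    ≡⟨ t₂′ ⟩
        ts m₂                  ≡⟨ t₂ ⟩
        ν τ y                  ∎
      where open ≤-Reasoning

  -- The maximum in dist(τ,y) is attained by the lists that visit all possible entries at y.
  Dist-transfer : ∀ {M ν M′ ν′} → GoodMem M → GoodViews M ν → GoodMem M′ → GoodViews M′ ν′ → ∀ τ y →
    (∀ {u} → EntryAt M (ν τ y) y u → EntryAt M′ (ν′ τ y) y u) →
    (∀ {u} → EntryAt M′ (ν′ τ y) y u → EntryAt M (ν τ y) y u) →
    (∀ {u} → EntryMax M y u → EntryMax M′ y u) →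
    ∀ {n} → Dist (mapRA ⟨ M , ν ⟩) τ y n → Dist (mapRA ⟨ M′ , ν′ ⟩) τ y n
  Dist-transfer {M} {ν} {M′} {ν′} gm gn gm′ gn′ τ y to from max {n} ((K , k , d) , bound)
    with Runs.full-run gm gn τ y | Runs.full-run gm′ gn′ τ y
  ... | L , h , visits | L′ , h′ , visits′ =
      (L′ , h′ , ≤-antisym (bound′ L′ h′) (subst (_≤ distance y L′) d (distance-mono y K L′
        (λ u∈ → visits′ (to (run-entries-∈ y k u∈))) (same-last k h′))))
    , bound′
    where
    same-last : ∀ {K K′} → mapRA ⟨ M , ν ⟩ τ K → mapRA ⟨ M′ , ν′ ⟩ τ K′ → last K y ≡ last K′ y
    same-last k k′ = Runs.entryMax-unique gm′ (max (run-last y k)) (run-last y k′)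
    bound′ : ∀ K′ → mapRA ⟨ M′ , ν′ ⟩ τ K′ → distance y K′ ≤ n
    bound′ K′ k′ = ≤-trans (distance-mono y K′ L
      (λ u∈ → visits (from (run-entries-∈ y k′ u∈))) (sym (same-last h k′))) (bound L h)

  -- Memory and views after a write.

  -- Expressions read only the values of stores, so thread identifiers, flags and timestamps may
  -- differ.
  AgreeOn : (Loc → Set) → PotStore → PotStore → Set
  AgreeOn P β′ β = ∀ z → P z → Entry.val (β′ z) ≡ Entry.val (β z)

  module Write {M ν} (gm : GoodMem M) (gn : GoodViews M ν) (τ : Tid) (x : Loc) (v t : ℕ)
               (fresh : ∀ m → M m × at-loc m ≡ x → ts m ≢ t) (later : ν τ x < t) where

    open GoodMem
    open GoodView

    V : View
    V = ν τ [ x ↦ t ]ᴸ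

    m₀ : Message
    m₀ = ⟨ x ∶ v at t , τ , V ⟩

    M′ : Memory
    M′ = M ∪ ｛ m₀ ｝

    ν′ : Tid → View
    ν′ = ν [ τ ↦ V ]ᵀ

    V-x : V x ≡ t
    V-x = update-same _≟ᴸ_ (ν τ) x t

    V-other : ∀ {z} → z ≢ x → V z ≡ ν τ z
    V-other = update-other _≟ᴸ_ (ν τ) x t

    V-grows : ∀ z → ν τ z ≤ V z
    V-grows z = update-elim _≟ᴸ_ (ν τ) x t (ν τ z ≤_) z (λ { refl → <⇒≤ later }) (const ≤-refl)

    ν′-grows : ∀ σ z → ν σ z ≤ ν′ σ z
    ν′-grows σ z = update-elim Finₚ._≟_ ν τ V (λ U → ν σ z ≤ U z) σ (λ { refl → V-grows z }) (const ≤-refl)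

    ν′-other : ∀ σ {z} → z ≢ x → ν′ σ z ≡ ν σ z
    ν′-other σ {z} neq = update-elim Finₚ._≟_ ν τ V (λ U → U z ≡ ν σ z) σ
      (λ { refl → V-other neq }) (const refl)

    ν′-τ : ν′ τ x ≡ t
    ν′-τ = trans (cong (λ U → U x) (update-same Finₚ._≟_ ν τ V)) V-x

    -- At `x` the new view points to `m₀` alone, as `t` is fresh; elsewhere it inherits from `ν τ`.
    good-V : GoodView M′ V
    good-V .current z with z ≟ᴸ x
    ... | yes refl = m₀ , inj₂ refl , refl , refl
    ... | no _ = let m , Mm , eq , e = gn τ .current z in m , inj₁ Mm , eq , e
    good-V .causal m (inj₂ refl) _ _ = ≤-refl
    good-V .causal m (inj₁ Mm) e z with at-loc m ≟ᴸ x
    ... | yes eq = contradiction e (fresh m (Mm , eq))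
    ... | no _ = ≤-trans (gn τ .causal m Mm e z) (V-grows z)

    -- Only `m₀` could violate causality, but at `x` an old view points to an old message, whose
    -- timestamp is not `t`.
    good-old : ∀ {U} → GoodView M U → GoodView M′ U
    good-old g .current z = let m , Mm , eq , e = g .current z in m , inj₁ Mm , eq , e
    good-old g .causal m (inj₁ Mm) e z = g .causal m Mm e z
    good-old g .causal _ (inj₂ refl) e z =
      let m , Mm , eq , e′ = g .current x in contradiction (trans e′ (sym e)) (fresh m (Mm , eq))

    gm′ : GoodMem M′
    gm′ .written = m₀ ∷ written gm
    gm′ .cover m (inj₁ Mm) = [ inj₁ , inj₂ ∘ there ]′ (cover gm m Mm)
    gm′ .cover m (inj₂ eq) = inj₂ (here (sym eq))
    gm′ .sound (here eq)  = inj₂ (sym eq)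
    gm′ .sound (there m∈) = inj₁ (sound gm m∈)
    gm′ .unique (inj₁ Mm) (inj₁ Mm′) eq e = unique gm Mm Mm′ eq e
    gm′ .unique (inj₁ Mm) (inj₂ refl) eq e = contradiction e (fresh _ (Mm , eq))
    gm′ .unique (inj₂ refl) (inj₁ Mm) eq e = contradiction (sym e) (fresh _ (Mm , sym eq))
    gm′ .unique (inj₂ refl) (inj₂ refl) _ _ = refl
    gm′ .view-ts (inj₁ Mm) = view-ts gm Mm
    gm′ .view-ts (inj₂ refl) = V-x
    gm′ .view-good (inj₁ Mm) = good-old (view-good gm Mm)
    gm′ .view-good (inj₂ refl) = good-V

    gn′ : GoodViews M′ ν′
    gn′ = good-update τ (λ σ → good-old (gn σ)) good-V

    module Old = Potential gm gn
    module New = Potential gm′ gn′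

    old : ∀ {m} → M′ m → at-loc m ≢ x → M m
    old (inj₁ Mm)   _   = Mm
    old (inj₂ refl) neq = contradiction refl neq

    -- The new message lies at `x`, so elsewhere neither maximality nor the presence of a successor
    -- changes.
    cov-to : ∀ {m} → at-loc m ≢ x → Cov M m → Cov M′ m
    cov-to neq (inj₁ newest) =
      inj₁ λ m′ (M′m′ , eq) → newest m′ (old M′m′ (neq ∘ trans (sym eq)) , eq)
    cov-to neq (inj₂ (m′ , (Mm′ , eq) , e)) = inj₂ (m′ , (inj₁ Mm′ , eq) , e)

    cov-from : ∀ {m} → at-loc m ≢ x → Cov M′ m → Cov M m
    cov-from neq (inj₁ newest) = inj₁ λ m′ (Mm′ , eq) → newest m′ (inj₁ Mm′ , eq)
    cov-from neq (inj₂ (m′ , (M′m′ , eq) , e)) = inj₂ (m′ , (old M′m′ (neq ∘ trans (sym eq)) , eq) , e)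

    entryOf-to : ∀ {m u} → at-loc m ≢ x → EntryOf M m u → EntryOf M′ m u
    entryOf-to {m} neq (a , b , F , c) = a , b , mk⇔ (cov-to {m} neq ∘ to) (from ∘ cov-from {m} neq) , c
      where open Equivalence F

    entryOf-from : ∀ {m u} → at-loc m ≢ x → EntryOf M′ m u → EntryOf M m u
    entryOf-from {m} neq (a , b , F , c) = a , b , mk⇔ (cov-from {m} neq ∘ to) (from ∘ cov-to {m} neq) , c
      where open Equivalence F

    entryAt-to : ∀ {σ y u} → y ≢ x → EntryAt M (ν σ y) y u → EntryAt M′ (ν′ σ y) y u
    entryAt-to {σ} neq (m , Mm , refl , le , e) =
      m , inj₁ Mm , refl , subst (_≤ ts m) (sym (ν′-other σ neq)) le , entryOf-to {m} neq e

    entryAt-from : ∀ {σ y u} → y ≢ x → EntryAt M′ (ν′ σ y) y u → EntryAt M (ν σ y) y u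
    entryAt-from {σ} neq (m , M′m , refl , le , e) =
      m , old M′m neq , refl , subst (_≤ ts m) (ν′-other σ neq) le , entryOf-from {m} neq e

    entryMax-to : ∀ {y u} → y ≢ x → EntryMax M y u → EntryMax M′ y u
    entryMax-to neq (m , Mm , refl , newest , e) = m , inj₁ Mm , refl
      , (λ m′ M′m′ eq → newest m′ (old M′m′ (neq ∘ trans (sym eq))) eq) , entryOf-to {m} neq e

    -- The case of a write on top of `x`: view maximality yields it for a store, coveredness for a
    -- fetch-and-add.
    module _ (newer : ∀ {m} → M m → at-loc m ≡ x → ts m < t) where

      m₀-newest : Newest M′ m₀
      m₀-newest m (inj₁ Mm) eq = <⇒≤ (newer Mm eq)
      m₀-newest m (inj₂ refl) eq = ≤-refl

      entryMax-m₀ : ∀ {u} → EntryMax M′ x u → EntryOf M′ m₀ u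
      entryMax-m₀ (m , M′m , eq , newest , e)
        with refl ← Runs.newest-unique gm′ {m} {m₀} M′m (inj₂ refl) eq newest m₀-newest = e

      entryAt-m₀ : ∀ {u} → EntryAt M′ (ν′ τ x) x u → EntryOf M′ m₀ u
      entryAt-m₀ (m , inj₁ Mm , eq , le , e) =
        contradiction (subst (_≤ ts m) ν′-τ le) (<⇒≱ (newer Mm eq))
      entryAt-m₀ (m , inj₂ refl , eq , le , e) = e

    -- Equal timestamps identify the message, even for different threads. Only values are compared,
    -- because the write may change the flag of an old message at `x`.
    head-agree : ∀ ν₁ ν₁′ {σ η β β′} → IsΔ σ ⟨ M , ν₁ ⟩ β → IsΔ η ⟨ M′ , ν₁′ ⟩ β′ →
      ∀ {z} → ν₁ σ z ≡ ν₁′ η z → Entry.val (β′ z) ≡ Entry.val (β z)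
    head-agree _ _ δ δ′ {z} e with δ z | δ′ z
    ... | m , (Mm , eq) , e₁ , v₁ , _ | m′ , (M′m′ , eq′) , e₁′ , v₁′ , _
      with refl ← unique gm′ (inj₁ Mm) M′m′ (trans eq (sym eq′)) (trans e₁ (trans e (sym e₁′))) =
        trans v₁′ (sym v₁)

    -- Simulation of lists after the write by lists before it.

    infix 4 _≼_
    -- The inequality at `x` ensures that an old message which can be propagated after the write can
    -- also be propagated in the simulating run.
    _≼_ : View → View → Set
    U ≼ U′ = (∀ {z} → z ≢ x → U z ≡ U′ z) × U x ≤ U′ x

    ≼⇒≤ : ∀ {U U′} → U ≼ U′ → ∀ z → U z ≤ U′ z
    ≼⇒≤ (eq , le) z with z ≟ᴸ x
    ... | yes refl = le
    ... | no neq   = ≤-reflexive (eq neq)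

    ≼-⊔ : ∀ {U U′} A → U ≼ U′ → U ⊔ⱽ A ≼ U′ ⊔ⱽ A
    ≼-⊔ A (eq , le) = (λ {z} neq → cong (_⊔ A z) (eq neq)) , ⊔-monoˡ-≤ (A x) le

    ≼-V : ∀ {U U′} → U ≼ U′ → U ⊔ⱽ ν τ ≼ U′ ⊔ⱽ V
    ≼-V (eq , le) = (λ neq → cong₂ _⊔_ (eq neq) (sym (V-other neq)))
      , ⊔-mono-≤ le (V-grows x)

    ≼-resp : ∀ {U₁ U₁′ U U′} → (∀ z → U₁ z ≡ U z) → U′ ≡ U₁′ → U ≼ U′ → U₁ ≼ U₁′
    ≼-resp same refl (eq , le) = (λ {z} neq → trans (same z) (eq neq)) , subst (_≤ _) (sym (same x)) le

    _≈ₓ_ : PotStore → PotStore → Set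
    _≈ₓ_ = AgreeOn (_≢ x)

    -- Off x, propagating the new message amounts to catching up with τ's view before the write.
    simulate : ∀ {ν₁ σ ν₁′ η L′} → GoodViews M ν₁ → ν₁ σ ≼ ν₁′ η → mapRA ⟨ M′ , ν₁′ ⟩ η L′ →
      ∃[ L ] mapRA ⟨ M , ν₁ ⟩ σ L × Emb _≈ₓ_ (toList L′) (toList L)
    simulate {ν₁} {σ} {ν₁′} {η} gn₁ r (end δ′ _) with Runs.run-exists gm gn₁ σ
    ... | L , h = L , h , keep (λ _ neq → head-agree ν₁ ν₁′ (run-head h) δ′ (proj₁ r neq)) []
    simulate {ν₁} {σ} {ν₁′} {η} gn₁ r (cons δ′ (prop {m = m} κ M′m lt) h′) with η Finₚ.≟ κ
    -- The views of other threads are not related. A propagation to one of them is matched by no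
    -- step, and the head of the simulating list is used again.
    ... | no neq with simulate gn₁ (≼-resp (λ _ → refl) (sym (update-other Finₚ._≟_ ν₁′ κ _ neq)) r) h′
    ...   | L , h , e = L , h , keep (λ _ neq′ → head-agree ν₁ ν₁′ (run-head h) δ′ (proj₁ r neq′)) e
    simulate {ν₁} {σ} {ν₁′} gn₁ r (cons δ′ (prop {m = m} κ (inj₁ Mm) lt) h′) | yes refl
      with simulate (good-prop σ gm gn₁ Mm)
             (≼-resp (λ z → cong (λ U → U z) (update-same Finₚ._≟_ ν₁ σ (ν₁ σ ⊔ⱽ view m)))
               (sym (update-same Finₚ._≟_ ν₁′ κ _)) (≼-⊔ (view m) r)) h′
    ... | L , h , e = _ , cons δ (prop σ Mm (≤-<-trans (≼⇒≤ r (at-loc m)) lt)) h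
        , keep (λ _ neq → head-agree ν₁ ν₁′ δ δ′ (proj₁ r neq)) (drop e)
      where δ = proj₂ (Runs.Δ-exists gm {τ = σ} gn₁)
    simulate {ν₁} {σ} {ν₁′} gn₁ r (cons δ′ (prop κ (inj₂ refl) lt) h′) | yes refl
      with Runs.catch-up gm (gn τ) gn₁ σ
    ... | ν₂ , gn₂ , same , extend
      with simulate gn₂ (≼-resp same (sym (update-same Finₚ._≟_ ν₁′ κ _)) (≼-V r)) h′
    ... | L , h , e with extend L h
    ...   | L₀ , h₀ , shift =
      L₀ , h₀ , keep (λ _ neq → head-agree ν₁ ν₁′ (run-head h₀) δ′ (proj₁ r neq)) (shift e)

    _≈_ : PotStore → PotStore → Set
    _≈_ = AgreeOn (λ _ → ⊤)

    FollowsWriter : List PotStore → Set₁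
    FollowsWriter K = ∃[ L ] mapRA ⟨ M , ν ⟩ τ L × Emb _≈ₓ_ K (toList L)

    -- Until it sees the new message, η behaves as before the write.  From then on
    -- its view includes that of τ.
    simulate-exact : ∀ {ν₁ ν₁′ η L′} → GoodViews M ν₁ → (∀ z → ν₁ η z ≡ ν₁′ η z) →
      mapRA ⟨ M′ , ν₁′ ⟩ η L′ →
      ∃[ L ] mapRA ⟨ M , ν₁ ⟩ η L × Emb² _≈_ _≈ₓ_ FollowsWriter (toList L′) (toList L)
    simulate-exact {ν₁} {ν₁′} {η} gn₁ r (end δ′ _) with Runs.run-exists gm gn₁ η
    ... | L , h = L , h , keep (λ z _ → head-agree ν₁ ν₁′ (run-head h) δ′ (r z)) []
    simulate-exact {ν₁} {ν₁′} {η} gn₁ r (cons δ′ (prop {m = m} κ M′m lt) h′) with η Finₚ.≟ κ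
    ... | no neq with simulate-exact gn₁
            (λ z → trans (r z) (cong (λ U → U z) (sym (update-other Finₚ._≟_ ν₁′ κ _ neq)))) h′
    ...   | L , h , e = L , h , keep (λ z _ → head-agree ν₁ ν₁′ (run-head h) δ′ (r z)) e
    simulate-exact {ν₁} {ν₁′} {η} gn₁ r (cons δ′ (prop {m = m} κ (inj₁ Mm) lt) h′) | yes refl
      with simulate-exact (good-prop κ gm gn₁ Mm)
             (λ z → trans (cong (λ U → U z) (update-same Finₚ._≟_ ν₁ κ _))
               (trans (cong (_⊔ view m z) (r z)) (cong (λ U → U z) (sym (update-same Finₚ._≟_ ν₁′ κ _))))) h′
    ... | L , h , e = _ , cons δ (prop κ Mm (subst (_< ts m) (sym (r (at-loc m))) lt)) h
        , keep (λ z _ → head-agree ν₁ ν₁′ δ δ′ (r z)) (drop e)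
      where δ = proj₂ (Runs.Δ-exists gm {τ = κ} gn₁)
    -- The observer catches up with the writer's old view, and the writer with the observer's. Both
    -- reach the join of the two views, so `simulate` embeds the same remaining list into a list of
    -- either.
    simulate-exact {ν₁} {ν₁′} {η} gn₁ r (cons δ′ (prop κ (inj₂ refl) lt) h′) | yes refl
      with Runs.catch-up gm (gn τ) gn₁ κ | Runs.catch-up gm (gn₁ κ) gn τ
    ... | ν₂ , gn₂ , same , extend | ν₃ , gn₃ , same₃ , extend₃
      with simulate gn₂ (≼-resp same after r≼) h′
         | simulate gn₃ (≼-resp (λ z → trans (same₃ z) (⊔-comm (ν τ z) (ν₁ κ z))) after r≼) h′
      where
      after = sym (update-same Finₚ._≟_ ν₁′ κ (ν₁′ κ ⊔ⱽ V))
      r≼ = ≼-V {ν₁ κ} {ν₁′ κ} ((λ {z} _ → r z) , ≤-reflexive (r x))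
    ... | L , h , e | L₃ , h₃ , e₃ with extend L h | extend₃ L₃ h₃
    ...   | L₀ , h₀ , shift | L₄ , h₄ , shift₃ =
      L₀ , h₀ , keep (λ z _ → head-agree ν₁ ν₁′ (run-head h₀) δ′ (r z))
        (jump (shift e) (L₄ , h₄ , shift₃ e₃))

  -- Preservation of assertions.

  record Refines (P : Loc → Set) (ℬ′ ℬ : PotMapping) : Set₁ where
    field
      lists : ∀ {η L′} → ℬ′ η L′ → ∃[ L ] ℬ η L
        × Emb (AgreeOn P) (toList L′) (toList L) × AgreeOn P (last L′) (last L)
      covered : ∀ {y} → P y → (∀ η L → ℬ η L → All (λ β → Entry.flag (β y) ≡ true) (toList L)) →
        ∀ η L′ → ℬ′ η L′ → All (λ β → Entry.flag (β y) ≡ true) (toList L′)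
      dist : ∀ {η y n} → P y → Dist ℬ η y n → Dist ℬ′ η y n
      common : ∀ {ω} → CommonLast ℬ ω → ∃[ ω′ ] CommonLast ℬ′ ω′ × AgreeOn P ω′ ω

  Refines-refl : ∀ {ℬ} → Refines (λ _ → ⊤) ℬ ℬ
  Refines-refl = record
    { lists   = λ {_} {L} h → L , h , Emb-refl (λ _ _ _ → refl) (toList L) , (λ _ _ → refl)
    ; covered = λ _ c → c
    ; dist    = λ _ d → d
    ; common  = λ {ω} c → ω , c , (λ _ _ → refl)
    }

  -- `P` separates `loc z` from `cur z`: before a thread sees a write at `x`, its stores keep their
  -- values at `x`, while the current value of `x` may already differ.
  Satᴵ-Emb : ∀ {P : XVar → Set} {γ γ′ ω ω′} → AgreeOn (λ z → P (cur z)) ω′ ω → ∀ I →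
    (∀ {v} → v ∈ varsᴵ I → P v) → (∀ {b} → reg b ∈ varsᴵ I → γ′ b ≡ γ b) →
    ∀ {L′ L} → Emb (AgreeOn (λ z → P (loc z))) L′ L → Satᴵ γ ω L I → Satᴵ γ′ ω′ L′ I
  Satᴵ-Emb {P} {γ} {γ′} {ω} {ω′} agree ⟦ E ⟧ ok okʳ =
    Emb-All λ {β′} {β} r → trans (sym (eval-cong E λ {v} v∈ → env r v v∈))
    where
    env : ∀ {β′ β} → AgreeOn (λ z → P (loc z)) β′ β → ∀ v → v ∈ vars E →
      envX γ β ω v ≡ envX γ′ β′ ω′ v
    env r (reg b) v∈ = sym (okʳ v∈)
    env r (loc z) v∈ = sym (r z (ok v∈))
    env r (cur z) v∈ = sym (agree z (ok v∈))
  Satᴵ-Emb {P} agree (I ⨾ J) ok okʳ e (L₁ , L₂ , refl , s₁ , s₂) with Emb-split L₁ e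
  ... | L₁′ , L₂′ , eq , e₁ , e₂ = L₁′ , L₂′ , eq
    , Satᴵ-Emb {P} agree I (ok ∘ ∈-++⁺ˡ) (okʳ ∘ ∈-++⁺ˡ) e₁ s₁
    , Satᴵ-Emb {P} agree J (ok ∘ ∈-++⁺ʳ (varsᴵ I)) (okʳ ∘ ∈-++⁺ʳ (varsᴵ I)) e₂ s₂

  OnLoc : (Loc → Set) → XVar → Set
  OnLoc P (reg _) = ⊤
  OnLoc P (loc z) = P z
  OnLoc P (cur z) = P z

  fv⇒OnLoc : ∀ {P I} → (∀ {z} → loc z ∈ fvᴵ I → P z) → ∀ {v} → v ∈ varsᴵ I → OnLoc P v
  fv⇒OnLoc ok {reg _} v∈ = tt
  fv⇒OnLoc ok {loc _} v∈ = ok (∈-map⁺ nameX v∈)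
  fv⇒OnLoc ok {cur _} v∈ = ok (∈-map⁺ nameX v∈)

  -- The frame property behind the three stability rules.
  Sat-Refines : ∀ {P γ γ′ pc pc′ ℬ ℬ′} → Refines P ℬ′ ℬ → ∀ φ →
    (∀ {z} → loc z ∈ fv φ → P z) → (∀ {b} → reg b ∈ fv φ → γ′ b ≡ γ b) →
    (∀ {l} → at l ⊑ φ → ∃[ τ ] pc τ ≡ l → ∃[ τ ] pc′ τ ≡ l) →
    Sat γ pc ℬ φ → Sat γ′ pc′ ℬ′ φ
  Sat-Refines {P} ref (τ ⋉ I) ok okʳ okᵖ s L′ h′ with Refines.lists ref h′
  ... | L , h , e , agree = Satᴵ-Emb {OnLoc P} agree I (fv⇒OnLoc {P} {I} ok) (okʳ ∘ ∈-map⁺ nameX) e (s L h)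
  Sat-Refines ref (C x) ok okʳ okᵖ s = Refines.covered ref (ok (here refl)) s
  Sat-Refines ref (dist[ τ , x ]≡ n) ok okʳ okᵖ s = Refines.dist ref (ok (here refl)) s
  Sat-Refines ref (¬↑ τ x) ok okʳ okᵖ (n , n≢0 , d) = n , n≢0 , Refines.dist ref (ok (here refl)) d
  Sat-Refines ref (at l) ok okʳ okᵖ (lift p) = lift (okᵖ here p)
  Sat-Refines {γ = γ} {γ′} ref (bexp B) ok okʳ okᵖ (ω , common , s) with Refines.common ref common
  ... | ω′ , common′ , agree = ω′ , common′ , trans (sym (eval-cong B (λ {v} → env v))) s
    where
    env : ∀ v → v ∈ vars B → envB γ ω v ≡ envB γ′ ω′ v
    env (reg b) v∈ = sym (okʳ (∈-map⁺ nameB v∈))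
    env (cur z) v∈ = sym (agree z (ok (∈-map⁺ nameB v∈)))
  Sat-Refines ref (φ ∧ ψ) ok okʳ okᵖ (s , s′) =
      Sat-Refines ref φ (ok ∘ ∈-++⁺ˡ) (okʳ ∘ ∈-++⁺ˡ) (okᵖ ∘ ∧ˡ) s
    , Sat-Refines ref ψ (ok ∘ ∈-++⁺ʳ (fv φ)) (okʳ ∘ ∈-++⁺ʳ (fv φ)) (okᵖ ∘ ∧ʳ) s′
  Sat-Refines ref (φ ∨ ψ) ok okʳ okᵖ (inj₁ s) =
    inj₁ (Sat-Refines ref φ (ok ∘ ∈-++⁺ˡ) (okʳ ∘ ∈-++⁺ˡ) (okᵖ ∘ ∨ˡ) s)
  Sat-Refines ref (φ ∨ ψ) ok okʳ okᵖ (inj₂ s) =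
    inj₂ (Sat-Refines ref ψ (ok ∘ ∈-++⁺ʳ (fv φ)) (okʳ ∘ ∈-++⁺ʳ (fv φ)) (okᵖ ∘ ∨ʳ) s)

  module WriteRefines {M ν} (gm : GoodMem M) (gn : GoodViews M ν) (τ : Tid) (x : Loc) (v t : ℕ)
                      (fresh : ∀ m → M m × at-loc m ≡ x → ts m ≢ t) (later : ν τ x < t) where

    open Write gm gn τ x v t fresh later public

    last-agree : ∀ {η σ ν₁ ν₁′ L L′} → mapRA ⟨ M , ν₁ ⟩ σ L → mapRA ⟨ M′ , ν₁′ ⟩ η L′ →
      last L′ ≈ₓ last L
    last-agree h h′ z neq = cong Entry.val
      (Runs.entryMax-unique gm′ (run-last z h′) (entryMax-to neq (run-last z h)))

    refines : Refines (_≢ x) (mapRA ⟨ M′ , ν′ ⟩) (mapRA ⟨ M , ν ⟩)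
    refines .Refines.lists {η} h′
      with simulate {ν} {η} gn (sym ∘ ν′-other η , ν′-grows η x) h′
    ... | L , h , e = L , h , e , last-agree h h′
    refines .Refines.covered {y} neq c η L′ h′ =
      All.map (Old.C⇒flag c ∘ entryAt-from {η} neq) (run-entries y h′)
    refines .Refines.dist {η} {y} neq =
      Dist-transfer gm gn gm′ gn′ η y (entryAt-to {η} neq) (entryAt-from {η} neq) (entryMax-to neq)
    refines .Refines.common common =
      let ω′ , common′ , max′ = New.common-last in
      ω′ , common′ , λ z neq → cong Entry.val (Runs.entryMax-unique gm′ (max′ z)
        (entryMax-to neq (Old.commonLast⇒entryMax common z)))

  -- The invariant in reachable states.

  Good : MState → Set
  Good q = GoodMem (MState.M q) × GoodViews (MState.M q) (MState.ν q)

  init-good : Good initM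
  init-good = record
    { written   = []
    ; cover     = λ { _ (_ , refl) → inj₁ refl }
    ; sound     = λ ()
    ; unique    = λ { (_ , refl) (_ , refl) refl _ → refl }
    ; view-ts   = λ { (_ , refl) → refl }
    ; view-good = λ { (_ , refl) → zero-good }
    } , const zero-good
    where
    zero-good : GoodView (MState.M initM) (const 0)
    zero-good = record
      { current = λ x → _ , (x , refl) , refl , refl
      ; causal  = λ { _ (_ , refl) _ _ → z≤n }
      }

  memory-good : ∀ {q τ ℓ q′} → q -[ τ , ℓ ]→ᴹ q′ → Good q → Good q′
  memory-good (read _ _) g = g
  memory-good (write {τ = τ} {x} {v} t fresh later) (gm , gn) = gm′ , gn′
    where open Write gm gn τ x v t fresh later
  memory-good (rmw _ w _) g = memory-good w g

  reachable-good : ∀ {P p q} → Reachable P (state p q) → Good q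
  reachable-good init = init-good
  reachable-good (step r (joint _ m)) = memory-good m (reachable-good r)
  reachable-good (step r (silent _)) = reachable-good r
  reachable-good (step r (internal (prop σ Mm _))) =
    let gm , gn = reachable-good r in gm , good-prop σ gm gn Mm

  -- Inversion of thread steps.

  store-inv : ∀ {K γ l x e ℓ r γ′} → (K , γ) -[ l ∶ STORE x e , ℓ ]→ (r , γ′) →
    ℓ ≡ W x (eval γ e) × γ′ ≡ γ
  store-inv store   = refl , refl
  store-inv (seq s) = store-inv s

  load-inv : ∀ {K γ l a x ℓ r γ′} → (K , γ) -[ l ∶ LOAD a x , ℓ ]→ (r , γ′) →
    ∃[ v ] ℓ ≡ R x v × γ′ ≡ γ [ a ↦ v ]ᴿ
  load-inv (load v) = v , refl , refl
  load-inv (seq s)  = load-inv s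

  fadd-inv : ∀ {K γ l a x e ℓ r γ′} → (K , γ) -[ l ∶ FADD a x e , ℓ ]→ (r , γ′) →
    ∃[ v ] ℓ ≡ RMW x v (v + eval γ e) × γ′ ≡ γ [ a ↦ v ]ᴿ
  fadd-inv (fadd v) = v , refl , refl
  fadd-inv (seq s)  = fadd-inv s

  assign-inv : ∀ {K γ l a e ℓ r γ′} → (K , γ) -[ l ∶ a ≔ e , ℓ ]→ (r , γ′) →
    ℓ ≡ ε × γ′ ≡ γ [ a ↦ eval γ e ]ᴿ
  assign-inv assign  = refl , refl
  assign-inv (seq s) = assign-inv s

  -- Inversion as an indexed type: matching on it puts both states into explicit form.
  data StoreStep (τ : Tid) (l : PC) (x : Loc) (e : Exp Reg nat) : State → State → Set₁ where
    stored : ∀ {𝒞 𝒞′ γ pc n M ν} t → pc τ ≡ l →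
      (∀ m → M m × at-loc m ≡ x → ts m ≢ t) → ν τ x < t →
      let V = ν τ [ x ↦ t ]ᴸ in
      StoreStep τ l x e (state (pstate 𝒞 γ pc) ⟨ M , ν ⟩)
        (state (pstate 𝒞′ γ (pc [ τ ↦ n ]ᵀ))
          ⟨ M ∪ ｛ ⟨ x ∶ eval γ e at t , τ , V ⟩ ｝ , ν [ τ ↦ V ]ᵀ ⟩)

  data LoadStep (τ : Tid) (l : PC) (a : Reg) (x : Loc) : State → State → Set₁ where
    loaded : ∀ {𝒞 𝒞′ γ pc n M ν} m → pc τ ≡ l → M m → at-loc m ≡ x → ν τ x ≡ ts m →
      LoadStep τ l a x (state (pstate 𝒞 γ pc) ⟨ M , ν ⟩)
        (state (pstate 𝒞′ (γ [ a ↦ val m ]ᴿ) (pc [ τ ↦ n ]ᵀ)) ⟨ M , ν ⟩)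

  data FaddStep (τ : Tid) (l : PC) (a : Reg) (x : Loc) (e : Exp Reg nat) : State → State → Set₁ where
    added : ∀ {𝒞 𝒞′ γ pc n M ν} m t → pc τ ≡ l → M m → at-loc m ≡ x → ν τ x ≡ ts m →
      (∀ m → M m × at-loc m ≡ x → ts m ≢ t) → ν τ x < t → t ≡ ν τ x + 1 →
      let V = ν τ [ x ↦ t ]ᴸ in
      FaddStep τ l a x e (state (pstate 𝒞 γ pc) ⟨ M , ν ⟩)
        (state (pstate 𝒞′ (γ [ a ↦ val m ]ᴿ) (pc [ τ ↦ n ]ᵀ))
          ⟨ M ∪ ｛ ⟨ x ∶ val m + eval γ e at t , τ , V ⟩ ｝ , ν [ τ ↦ V ]ᵀ ⟩)

  data AssignStep (τ : Tid) (l : PC) (a : Reg) (e : Exp Reg nat) : State → State → Set₁ where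
    assigned : ∀ {𝒞 𝒞′ γ pc n q} → pc τ ≡ l →
      AssignStep τ l a e (state (pstate 𝒞 γ pc) q)
        (state (pstate 𝒞′ (γ [ a ↦ eval γ e ]ᴿ) (pc [ τ ↦ n ]ᵀ)) q)

  storeStep : ∀ {P τ l x e n 𝐪 𝐪′} → Step P 𝐪 (thread τ l (STORE x e) n) 𝐪′ → StoreStep τ l x e 𝐪 𝐪′
  storeStep (joint (step _ at-l s) m) with store-inv s
  storeStep (joint (step _ at-l s) (write t fresh later)) | refl , refl = stored t at-l fresh later
  storeStep (silent (step _ _ s)) with store-inv s
  ... | () , _

  loadStep : ∀ {P τ l a x n 𝐪 𝐪′} → Step P 𝐪 (thread τ l (LOAD a x) n) 𝐪′ → LoadStep τ l a x 𝐪 𝐪′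
  loadStep (joint (step _ at-l s) m) with load-inv s
  loadStep (joint (step _ at-l s) (read (Mm , eq) e)) | v , refl , refl = loaded _ at-l Mm eq e
  loadStep (silent (step _ _ s)) with load-inv s
  ... | _ , () , _

  faddStep : ∀ {P τ l a x e n 𝐪 𝐪′} → Step P 𝐪 (thread τ l (FADD a x e) n) 𝐪′ → FaddStep τ l a x e 𝐪 𝐪′
  faddStep (joint (step _ at-l s) m) with fadd-inv s
  faddStep {τ = τ} {x = x} (joint {q = q} (step _ at-l s) (rmw (read (Mm , eq) e) (write t fresh later) inc))
    | v , refl , refl = added _ t at-l Mm eq e fresh later
      (trans (sym (trans (cong (λ U → U x) (update-same Finₚ._≟_ (MState.ν q) τ _))
        (update-same _≟ᴸ_ (MState.ν q τ) x t))) inc)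
  faddStep (silent (step _ _ s)) with fadd-inv s
  ... | _ , () , _

  assignStep : ∀ {P τ l a e n 𝐪 𝐪′} → Step P 𝐪 (thread τ l (a ≔ e) n) 𝐪′ → AssignStep τ l a e 𝐪 𝐪′
  assignStep (joint (step _ _ s) m) with assign-inv s
  assignStep (joint (step _ _ s) ()) | refl , refl
  assignStep (silent (step _ at-l s)) with assign-inv s
  ... | refl , refl = assigned at-l

  -- Program counters, registers and substitution.

  -- Only `τ` moves, and before the step it could witness no assertion but `at l`.
  at-stable : ∀ {pc : Tid → PC} {τ l n φ} → pc τ ≡ l → at l ⋢ φ →
    ∀ {l′} → at l′ ⊑ φ → ∃[ σ ] pc σ ≡ l′ → ∃[ σ ] (pc [ τ ↦ n ]ᵀ) σ ≡ l′
  at-stable {pc} {τ} at-l absent sub (σ , refl) with σ Finₚ.≟ τ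
  ... | yes refl = contradiction (subst (λ l → at l ⊑ _) at-l sub) absent
  ... | no neq   = σ , update-other Finₚ._≟_ pc τ _ neq

  reg-stable : ∀ {γ : Store} {a v} {N : List Name} → reg a ∉ N → ∀ {b} → reg b ∈ N → (γ [ a ↦ v ]ᴿ) b ≡ γ b
  reg-stable {γ} {a} absent b∈ = update-other _≟ᴿ_ γ a _ λ { refl → absent b∈ }

  loc-stable : ∀ {x} {N : List Name} → loc x ∉ N → ∀ {z} → loc z ∈ N → z ≢ x
  loc-stable absent z∈ refl = absent z∈

  eval-subst-reg : ∀ {A} {a : Reg} {F : Exp A nat} {v} {ρ : A → ℕ} {γ : Store} {var-reg : Reg → Exp A nat} →
    (∀ b → eval ρ (var-reg b) ≡ γ b) → eval ρ F ≡ v → ∀ b →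
    eval ρ (if does (b ≟ᴿ a) then F else var-reg b) ≡ (γ [ a ↦ v ]ᴿ) b
  eval-subst-reg {a = a} h eqF b with b ≟ᴿ a
  ... | yes _ = eqF
  ... | no _  = h b

  eval-substˣ : ∀ {s γ β ω v} a F → eval (envX γ β ω) F ≡ v → (E : Exp XVar s) →
    eval (envX γ β ω) (E [ a ≔ F ]ˣ) ≡ eval (envX (γ [ a ↦ v ]ᴿ) β ω) E
  eval-substˣ a F eqF E = eval-bind _
    (λ { (reg b) → eval-subst-reg {var-reg = var ∘ reg} (λ _ → refl) eqF b ; (loc _) → refl ; (cur _) → refl }) E

  eval-substᴮ : ∀ {s γ ω v} a F → eval (envB γ ω) F ≡ v → (B : Exp BVar s) →
    eval (envB γ ω) (B [ a ≔ F ]ᴮ) ≡ eval (envB (γ [ a ↦ v ]ᴿ) ω) B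
  eval-substᴮ a F eqF B = eval-bind _
    (λ { (reg b) → eval-subst-reg {var-reg = var ∘ reg} (λ _ → refl) eqF b ; (cur _) → refl }) B

  eval-toX : ∀ {s γ β ω} (e : Exp Reg s) → eval (envX γ β ω) (toX e) ≡ eval γ e
  eval-toX = eval-bind _ (λ _ → refl)

  eval-toB : ∀ {s γ ω} (e : Exp Reg s) → eval (envB γ ω) (toB e) ≡ eval γ e
  eval-toB = eval-bind _ (λ _ → refl)

  ≐-true : ∀ {m n} → m ≡ n → (m ≡ᵇ n) ≡ true
  ≐-true {m} refl = Equivalence.to T-≡ (≡⇒≡ᵇ m m refl)

  ≐-true⁻ : ∀ {m n} → (m ≡ᵇ n) ≡ true → m ≡ n
  ≐-true⁻ eq = ≡ᵇ⇒≡ _ _ (Equivalence.from T-≡ eq)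

  Satᴵ-subst : ∀ {γ ω L} a e I → Satᴵ γ ω L (I [ a ≔ e ]ᴵ) → Satᴵ (γ [ a ↦ eval γ e ]ᴿ) ω L I
  Satᴵ-subst a e ⟦ E ⟧ s =
    All.map (λ eq → trans (sym (eval-substˣ a (toX e) (eval-toX e) E)) eq) s
  Satᴵ-subst a e (I ⨾ J) (L₁ , L₂ , eq , s₁ , s₂) =
    L₁ , L₂ , eq , Satᴵ-subst a e I s₁ , Satᴵ-subst a e J s₂

  Sat-subst : ∀ {γ pc pc′ ℬ} a e φ →
    (∀ {l} → at l ⊑ φ → ∃[ τ ] pc τ ≡ l → ∃[ τ ] pc′ τ ≡ l) →
    Sat γ pc ℬ (φ [ a ≔ e ]ᴬ) → Sat (γ [ a ↦ eval γ e ]ᴿ) pc′ ℬ φ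
  Sat-subst a e (τ ⋉ I) okᵖ s L h = Satᴵ-subst a e I (s L h)
  Sat-subst a e (C x) okᵖ s = s
  Sat-subst a e (dist[ τ , x ]≡ n) okᵖ s = s
  Sat-subst a e (¬↑ τ x) okᵖ s = s
  Sat-subst a e (at l) okᵖ (lift p) = lift (okᵖ here p)
  Sat-subst a e (bexp B) okᵖ (ω , common , s) =
    ω , common , trans (sym (eval-substᴮ a (toB e) (eval-toB e) B)) s
  Sat-subst a e (φ ∧ ψ) okᵖ (s , s′) = Sat-subst a e φ (okᵖ ∘ ∧ˡ) s , Sat-subst a e ψ (okᵖ ∘ ∧ʳ) s′
  Sat-subst a e (φ ∨ ψ) okᵖ (inj₁ s) = inj₁ (Sat-subst a e φ (okᵖ ∘ ∨ˡ) s)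
  Sat-subst a e (φ ∨ ψ) okᵖ (inj₂ s) = inj₂ (Sat-subst a e ψ (okᵖ ∘ ∨ʳ) s)

  -- Soundness of the rules.

  module _ (τ : Tid) (l : PC) where

    stbl-st : ∀ x e φ → loc x ∉ fv φ → at l ⋢ φ → ⟪ φ ⟫ τ ↦ l ∶ STORE x e ⟪ φ ⟫
    stbl-st x e φ x∉ at∉ P 𝐪 𝐪′ n reach s st with storeStep st
    ... | stored {γ = γ} t at-l fresh later = Sat-Refines refines φ (loc-stable x∉) (const refl) (at-stable at-l at∉) s
      where open WriteRefines (proj₁ (reachable-good reach)) (proj₂ (reachable-good reach)) τ x (eval γ e) t fresh later

    stbl-rmw : ∀ a x e φ → loc x ∉ fv φ → reg a ∉ fv φ → at l ⋢ φ → ⟪ φ ⟫ τ ↦ l ∶ FADD a x e ⟪ φ ⟫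
    stbl-rmw a x e φ x∉ a∉ at∉ P 𝐪 𝐪′ n reach s st with faddStep st
    ... | added {γ = γ} m t at-l _ _ _ fresh later _ =
          Sat-Refines refines φ (loc-stable x∉) (reg-stable {γ} a∉) (at-stable at-l at∉) s
      where open WriteRefines (proj₁ (reachable-good reach)) (proj₂ (reachable-good reach)) τ x
                   (val m + eval γ e) t fresh later

    stbl-ld : ∀ a x φ → reg a ∉ fv φ → at l ⋢ φ → ⟪ φ ⟫ τ ↦ l ∶ LOAD a x ⟪ φ ⟫
    stbl-ld a x φ a∉ at∉ P 𝐪 𝐪′ n reach s st with loadStep st
    ... | loaded {γ = γ} m at-l _ _ _ =
      Sat-Refines Refines-refl φ (const tt) (reg-stable {γ} a∉) (at-stable at-l at∉) s

    sub : ∀ a e φ → at l ⋢ φ → ⟪ φ [ a ≔ e ]ᴬ ⟫ τ ↦ l ∶ a ≔ e ⟪ φ ⟫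
    sub a e φ at∉ P 𝐪 𝐪′ n reach s st with assignStep st
    ... | assigned at-l = Sat-subst a e φ (at-stable at-l at∉) s

    pc-rule : ∀ c → ⟪ at l ⟫ τ ↦ l ∶ c ⟪next at ⟫
    pc-rule c P 𝐪 𝐪′ n reach s (joint (step {pc = pc} _ _ _) _) = lift (τ , update-same Finₚ._≟_ pc τ n)
    pc-rule c P 𝐪 𝐪′ n reach s (silent (step {pc = pc} _ _ _))  = lift (τ , update-same Finₚ._≟_ pc τ n)

    -- View maximality places `t` above all timestamps at `x`. So `m₀` is the newest message and the
    -- only one at `x` that lists of `τ` can still display.
    st : ∀ x e → ⟪ τ ↑ x ⟫ τ ↦ l ∶ STORE x e
      ⟪ τ ↑ x ∧ τ ⋉ ⟦ var (loc x) ≐ toX e ⟧ ∧ bexp (var (cur x) ≐ toB e) ⟫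
    st x e P 𝐪 𝐪′ n reach d step′ with storeStep step′
    ... | stored {γ = γ} {M = M} {ν = ν} t at-l fresh later =
        ( (let L , h = Runs.run-exists gm′ gn′ τ in L , h , dist≡0 h)
        , λ L h → ≤-reflexive (dist≡0 h))
      , (λ L h → All.map (λ ea → ≐-true (trans (proj₁ (entryAt-m₀ newer ea)) (sym (eval-toX e)))) (run-entries x h))
      , (let ω , common , max = New.common-last in
          ω , common , ≐-true (trans (proj₁ (entryMax-m₀ newer (max x))) (sym (eval-toB e))))
      where
      open WriteRefines (proj₁ (reachable-good reach)) (proj₂ (reachable-good reach)) τ x (eval γ e) t fresh later
      newer : ∀ {m} → M m → at-loc m ≡ x → ts m < t
      newer Mm eq = ≤-<-trans (Old.up-to-date d Mm eq) later
      dist≡0 : ∀ {L} → mapRA ⟨ M′ , ν′ ⟩ τ L → distance x L ≡ 0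
      dist≡0 {L} h = constant⇒distance≡0 x L (All.map
        (λ ea → entryOf-unique {M′} {m₀} (entryAt-m₀ newer ea) (entryMax-m₀ newer (run-last x h))) (run-entries x h))

    -- Before `η` sees the write, its stores keep their values, so `I` is inherited on the part
    -- matched to `A`. If `η` sees it within that part, the rest follows a list of `τ`, all of which
    -- satisfies `Iτ`; otherwise the rest embeds into `B`. The current value of `x` may change at
    -- once, so `I` must not mention it.
    st-other : ∀ η x e I Iτ → η ≢ τ → loc x ∉ fvᴵ Iτ → cur x ∉ varsᴵ I →
      ⟪ τ ⋉ Iτ ∧ η ⋉ (I ⨾ Iτ) ⟫ τ ↦ l ∶ STORE x e ⟪ η ⋉ (I ⨾ Iτ) ⟫
    st-other η x e I Iτ η≢τ x∉ curx∉ P 𝐪 𝐪′ n reach (sτ , sη) step′ L′ h′ with storeStep step′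
    ... | stored {γ = γ} {M = M} {ν = ν} t at-l fresh later
      with simulate-exact gn (λ z → sym (cong (λ U → U z) (update-other Finₚ._≟_ ν τ _ η≢τ))) h′
      where
      gn = proj₂ (reachable-good reach)
      open WriteRefines (proj₁ (reachable-good reach)) gn τ x (eval γ e) t fresh later
    ... | L , h , emb with sη L h
    ...   | A , B , eq , sA , sB = split
      where
      open WriteRefines (proj₁ (reachable-good reach)) (proj₂ (reachable-good reach)) τ x (eval γ e) t fresh later
      satτ : ∀ {σ L K K′} → mapRA ⟨ M , ν ⟩ σ L → Emb _≈ₓ_ K′ K → Satᴵ γ (last L) K Iτ → Satᴵ γ (last L′) K′ Iτ
      satτ h e s = Satᴵ-Emb {OnLoc (_≢ x)} (last-agree h h′) Iτ
        (fv⇒OnLoc {_≢ x} {Iτ} (loc-stable x∉)) (const refl) e s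
      satI : ∀ {K K′} → Emb _≈_ K′ K → Satᴵ γ (last L) K I → Satᴵ γ (last L′) K′ I
      satI e s = Satᴵ-Emb {λ v → v ≢ cur x} (λ z neq → last-agree h h′ z (λ { refl → neq refl })) I
        (λ { v∈ refl → curx∉ v∈ }) (const refl) (weaken e) s
        where
        weaken : ∀ {K K′} → Emb _≈_ K′ K → Emb (AgreeOn (λ z → loc z ≢ cur x)) K′ K
        weaken []         = []
        weaken (keep r e) = keep (λ z _ → r z tt) (weaken e)
        weaken (drop e)   = drop (weaken e)
      split : Satᴵ γ (last L′) (toList L′) (I ⨾ Iτ)
      split with Emb²-split (λ r z _ → r z tt) A (subst (Emb² _≈_ _≈ₓ_ FollowsWriter (toList L′)) eq emb)
      ... | A′ , B′ , eq′ , e₁ , inj₁ e₂ = A′ , B′ , eq′ , satI e₁ sA , satτ h e₂ sB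
      ... | A′ , B′ , eq′ , e₁ , inj₂ (K , k , e₂) = A′ , B′ , eq′ , satI e₁ sA , satτ k e₂ (sτ K k)

    -- The message read is covered, yet the next timestamp is free for the write, so it is the
    -- newest one and carries the current value.
    rmw-rule : ∀ a x e₁ e₂ → a ∉ vars e₁ → a ∉ vars e₂ →
      ⟪ C x ∧ bexp (var (cur x) ≐ toB e₁) ⟫ τ ↦ l ∶ FADD a x e₂
      ⟪ C x ∧ bexp (var (cur x) ≐ toB (e₁ ⊕ e₂)) ∧ τ ⋉ ⟦ var (loc x) ≐ toX (e₁ ⊕ e₂) ⟧ ⟫
    rmw-rule a x e₁ e₂ a∉₁ a∉₂ P 𝐪 𝐪′ n reach (cx , ω , common , current) step′ with faddStep step′
    ... | added {γ = γ} {M = M} {ν = ν} mᵣ t at-l Mmᵣ refl e fresh later inc =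
        (λ σ L′ h′ → All.map (still-covered {σ}) (run-entries x h′))
      , (let ω′ , common′ , max′ = New.common-last in
          ω′ , common′ , ≐-true (trans (proj₁ (entryMax-m₀ newer (max′ x)))
            (trans sum (sym (eval-toB (e₁ ⊕ e₂))))))
      , (λ L h → All.map (λ ea → ≐-true (trans (proj₁ (entryAt-m₀ newer ea))
            (trans sum (sym (eval-toX (e₁ ⊕ e₂)))))) (run-entries x h))
      where
      gm = proj₁ (reachable-good reach)
      open WriteRefines gm (proj₂ (reachable-good reach)) τ x (val mᵣ + eval γ e₂) t fresh later
      t≡ : t ≡ ts mᵣ + 1
      t≡ = trans inc (cong (_+ 1) e)
      -- `C x` speaks of flags only, so an entry of `m` is built first and its flag is read back.
      covered : ∀ {m σ} → M m → at-loc m ≡ x → ν σ x ≤ ts m → Cov M m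
      covered {m} {σ} Mm eq le = let u , eu@(_ , _ , F , _) = Runs.entry-exists gm m in
        Equivalence.to F (Old.C⇒flag cx {σ} (m , Mm , eq , le , eu))
      -- The timestamp after that of mᵣ is free.
      mᵣ-newest : Newest M mᵣ
      mᵣ-newest with covered {mᵣ} {τ} Mmᵣ refl (≤-reflexive e)
      ... | inj₁ newest = λ m Mm eq → newest m (Mm , eq)
      ... | inj₂ (m , Mm , t′) = contradiction (trans t′ (sym t≡)) (fresh m Mm)
      newer : ∀ {m} → M m → at-loc m ≡ x → ts m < t
      newer {m} Mm eq = subst (ts m <_) (trans (+-comm 1 (ts mᵣ)) (sym t≡)) (s≤s (mᵣ-newest m Mm eq))
      val-mᵣ : val mᵣ ≡ eval γ e₁
      val-mᵣ with Old.commonLast⇒entryMax common x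
      ... | m , Mm , eq , newest , (v , _)
        with refl ← Runs.newest-unique gm {m} {mᵣ} Mm Mmᵣ eq newest mᵣ-newest =
          trans (sym v) (trans (≐-true⁻ current) (eval-toB e₁))
      γ′ = γ [ a ↦ val mᵣ ]ᴿ
      unchanged : ∀ (f : Exp Reg nat) → a ∉ vars f → eval γ f ≡ eval γ′ f
      unchanged f a∉ = eval-cong f λ v∈ → sym (update-other _≟ᴿ_ γ a _ λ { refl → a∉ v∈ })
      sum : val mᵣ + eval γ e₂ ≡ eval γ′ e₁ + eval γ′ e₂
      sum = cong₂ _+_ (trans val-mᵣ (unchanged e₁ a∉₁)) (unchanged e₂ a∉₂)
      still-covered : ∀ {σ u} → EntryAt M′ (ν′ σ x) x u → Entry.flag u ≡ true
      still-covered (_ , inj₂ refl , _ , _ , (_ , _ , F , _)) =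
        Equivalence.from F (inj₁ λ m (M′m , eq) → m₀-newest newer m M′m eq)
      still-covered {σ} (m , inj₁ Mm , eq , le , (_ , _ , F , _)) =
        Equivalence.from F (cov (covered {m} {σ} Mm eq (≤-trans (ν′-grows σ x) le)))
        where
        cov : Cov M m → Cov M′ m
        cov (inj₂ (m′ , (Mm′ , eq′) , t′)) = inj₂ (m′ , (inj₁ Mm′ , eq′) , t′)
        -- A message that was covered by being newest is `mᵣ`; now `m₀` covers it as its direct
        -- successor.
        cov (inj₁ newest) with refl ← Runs.newest-unique gm {m} {mᵣ} Mm Mmᵣ eq
              (λ m′ Mm′ eq′ → newest m′ (Mm′ , eq′)) mᵣ-newest =
          inj₂ (m₀ , (inj₂ refl , refl) , t≡)

    -- View maximality makes the message read the newest one, so `a` receives the current value of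
    -- `x`.
    ld : ∀ a x (e : Exp Reg bool) →
      ⟪ τ ↑ x ∧ bexp (toB e [ a ≔ var (cur x) ]ᴮ) ⟫ τ ↦ l ∶ LOAD a x ⟪ bexp (toB e) ⟫
    ld a x e P 𝐪 𝐪′ n reach (d , ω , common , s) step′ with loadStep step′
    ... | loaded {γ = γ} {M = M} {ν = ν} mᵣ at-l Mmᵣ refl eqᵣ =
        ω , common , trans (sym (eval-substᴮ a (var (cur x)) current (toB e))) s
      where
      gm = proj₁ (reachable-good reach)
      open Potential gm (proj₂ (reachable-good reach))
      current : Entry.val (ω x) ≡ val mᵣ
      current with commonLast⇒entryMax common x
      ... | m , Mm , eq , newest , (v , _)
        with refl ← Runs.newest-unique gm {m} {mᵣ} Mm Mmᵣ eq newest
               (λ m′ Mm′ eq′ → ≤-trans (up-to-date d Mm′ eq′) (≤-reflexive eqᵣ)) = v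

    -- Whether `e` holds after the load is decided. If it fails, the first segment of every list is
    -- empty, so `I` holds of whole lists and the assumed triple applies to this same step.
    ld-sh : ∀ a x (e : Exp Reg bool) I ψ → ⟪ τ ⋉ I ⟫ τ ↦ l ∶ LOAD a x ⟪ ψ ⟫ →
      ⟪ τ ⋉ (⟦ toX e [ a ≔ var (loc x) ]ˣ ⟧ ⨾ I) ⟫ τ ↦ l ∶ LOAD a x ⟪ bexp (toB e) ∨ ψ ⟫
    ld-sh a x e I ψ triple P 𝐪 𝐪′ n reach s step′ with loadStep step′
    ... | loaded {γ = γ} {M = M} {ν = ν} mᵣ at-l Mmᵣ refl eqᵣ
      with eval (γ [ a ↦ val mᵣ ]ᴿ) e in eq
    ...   | true  = let ω , common , _ = Potential.common-last gm gn in
      inj₁ (ω , common , trans (eval-toB e) eq)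
      where
      gm = proj₁ (reachable-good reach)
      gn = proj₂ (reachable-good reach)
    -- The value read is that of the first store, where e(a := x) therefore fails.
    ...   | false = inj₂ (triple P _ _ n reach skip-first step′)
      where
      gm = proj₁ (reachable-good reach)
      skip-first : ∀ L → mapRA ⟨ M , ν ⟩ τ L → Satᴵ γ (last L) (toList L) I
      skip-first L h with s L h
      ... | [] , L₂ , eqL , _ , sI = subst (λ K → Satᴵ γ (last L) K I) (sym eqL) sI
      ... | β ∷ L₁ , L₂ , refl , holds ∷ _ , sI with run-head h x
      ...   | m , (Mm , eqm) , t , v , _
        with refl ← GoodMem.unique gm Mm Mmᵣ eqm (trans t eqᵣ) =
          contradiction (trans (sym holds) (trans (eval-substˣ a (var (loc x)) v (toX e))
            (trans (eval-toX e) eq))) λ ()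

theorem1 : (S : Signature) → let open Piccolo S in
    (τ : Tid) (l : PC) → pcTid l ≡ τ →
    (∀ (x : Loc) (e : Exp Reg nat) (φ : Assn) → loc x ∉ fv φ → at l ⋢ φ →
    ⟪ φ ⟫ τ ↦ l ∶ STORE x e ⟪ φ ⟫)
    × (∀ (a : Reg) (x : Loc) (e : Exp Reg nat) (φ : Assn) →
    loc x ∉ fv φ → reg a ∉ fv φ → at l ⋢ φ → (∀ y → ¬↑ τ y ⋢ φ) →
    ⟪ φ ⟫ τ ↦ l ∶ FADD a x e ⟪ φ ⟫)
    × (∀ (a : Reg) (x : Loc) (φ : Assn) →
    reg a ∉ fv φ → at l ⋢ φ → (∀ y → ¬↑ τ y ⋢ φ) →
    ⟪ φ ⟫ τ ↦ l ∶ LOAD a x ⟪ φ ⟫)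
    × (∀ (a : Reg) (e : Exp Reg nat) (φ : Assn) → at l ⋢ φ →
    ⟪ φ [ a ≔ e ]ᴬ ⟫ τ ↦ l ∶ a ≔ e ⟪ φ ⟫)
    × (∀ (c : Cmd) → ⟪ at l ⟫ τ ↦ l ∶ c ⟪next at ⟫)
    × (∀ (x : Loc) (e : Exp Reg nat) →
    ⟪ τ ↑ x ⟫ τ ↦ l ∶ STORE x e
    ⟪ τ ↑ x ∧ τ ⋉ ⟦ var (loc x) ≐ toX e ⟧ ∧ bexp (var (cur x) ≐ toB e) ⟫)
    × (∀ (η : Tid) (x : Loc) (e : Exp Reg nat) (I Iτ : IAssn) →
    η ≢ τ → loc x ∉ fvᴵ Iτ → cur x ∉ varsᴵ I →
    ⟪ τ ⋉ Iτ ∧ η ⋉ (I ⨾ Iτ) ⟫ τ ↦ l ∶ STORE x e ⟪ η ⋉ (I ⨾ Iτ) ⟫)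
    × (∀ (a : Reg) (x : Loc) (e₁ e₂ : Exp Reg nat) →
    a ∉ vars e₁ → a ∉ vars e₂ →
    ⟪ C x ∧ bexp (var (cur x) ≐ toB e₁) ⟫ τ ↦ l ∶ FADD a x e₂
    ⟪ C x ∧ bexp (var (cur x) ≐ toB (e₁ ⊕ e₂))
    ∧ τ ⋉ ⟦ var (loc x) ≐ toX (e₁ ⊕ e₂) ⟧ ⟫)
    × (∀ (a : Reg) (x : Loc) (e : Exp Reg bool) →
    ⟪ τ ↑ x ∧ bexp (toB e [ a ≔ var (cur x) ]ᴮ) ⟫ τ ↦ l ∶ LOAD a x ⟪ bexp (toB e) ⟫)
    × (∀ (a : Reg) (x : Loc) (e : Exp Reg bool) (I : IAssn) (ψ : Assn) →
    ⟪ τ ⋉ I ⟫ τ ↦ l ∶ LOAD a x ⟪ ψ ⟫ →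
    ⟪ τ ⋉ (⟦ toX e [ a ≔ var (loc x) ]ˣ ⟧ ⨾ I) ⟫ τ ↦ l ∶ LOAD a x
    ⟪ bexp (toB e) ∨ ψ ⟫)
theorem1 S τ l _ =
    stbl-st τ l
  , (λ a x e φ x∉ a∉ at∉ _ → stbl-rmw τ l a x e φ x∉ a∉ at∉)
  , (λ a x φ a∉ at∉ _ → stbl-ld τ l a x φ a∉ at∉)
  , sub τ l
  , pc-rule τ l
  , st τ l
  , st-other τ l
  , rmw-rule τ l
  , ld τ l
  , ld-sh τ l
  where open Soundness S
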